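{- (1) For every integer $k\ge 2$ there is a homomorphism $\mathrm{SG}(2k+2,k)\to S_4$. (2) For every positive integer $k$ there is no homomorphism $\mathrm{KG}(2k+2,k)\to S_4$.
   Context: The Kneser graph $\mathrm{KG}(n,k)$ ($n\ge 2k$) has as vertices all $k$-element subsets of $[n]=\{1,\dots,n\}$, two being adjacent iff they are disjoint. The Schrijver graph $\mathrm{SG}(n,k)$ is the induced subgraph of $\mathrm{KG}(n,k)$ on the stable $k$-subsets, i.e., those $A$ containing no pair $\{i,i+1\}$ for $i\in[n-1]$ and not containing both $1$ and $n$. The symmetric shift graph $S_m$ has vertex set $\{(i,j):1\le i,j\le m,\ i\ne j\}$, and $(i,j)$ is adjacent to $(k,\ell)$ iff $j=k$ or $i=\ell$. A homomorphism is an edge-preserving map between vertex sets. -}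

module Defs where

open import Data.Fin using (Fin; toℕ)
open import Data.Fin.Subset using (Subset; _∈_; _∩_; ∣_∣; Empty)
open import Data.Fin.Subset.Properties using (∩-comm)
open import Data.Nat using (ℕ; suc)
open import Data.Product using (_×_; _,_; proj₁; proj₂)
open import Data.Refinement using (Refinement-syntax; value)
open import Data.Sum using (_⊎_; inj₁; inj₂)
open import Relation.Binary.Definitions using (Symmetric)
open import Relation.Binary.PropositionalEquality using (_≡_; _≢_; sym; subst)
open import Relation.Nullary using (¬_)

-- Undirected graphs. Loops are not excluded by the type because KG(n,0)
-- has one; KG(n,k) with k ≥ 1 and all S_m are loopless.
record Graph : Set₁ where
  field
    Vertex : Set
    Adj    : Vertex → Vertex → Set
    Adj-sym : Symmetric Adj

open Graph public

record Homomorphism (G H : Graph) : Set where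
  field
    map       : Vertex G → Vertex H
    preserves : ∀ {u v} → Adj G u v → Adj H (map u) (map v)

-- The membership proofs in [ v ∈ A ∣ P v ] are irrelevant, so vertices of
-- the graphs below are equal as soon as their underlying values are.
Induced : (G : Graph) → (Vertex G → Set) → Graph
Induced G P = record
  { Vertex  = [ v ∈ Vertex G ∣ P v ]
  ; Adj     = λ u v → Adj G (value u) (value v)
  ; Adj-sym = Adj-sym G
  }

-- [n] = {1,…,n} is represented by Fin n, with i ∈ [n] at toℕ-value i - 1.
KG : (n k : ℕ) → Graph
KG n k = record
  { Vertex  = [ A ∈ Subset n ∣ ∣ A ∣ ≡ k ]
  ; Adj     = λ A B → Empty (value A ∩ value B)
  ; Adj-sym = λ {A} {B} → subst Empty (∩-comm (value A) (value B))
  }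

Stable : ∀ {n} → Subset n → Set
Stable {n} A =
    (∀ (i j : Fin n) → toℕ j ≡ suc (toℕ i) → ¬ (i ∈ A × j ∈ A))
  × (∀ (i j : Fin n) → toℕ i ≡ 0 → suc (toℕ j) ≡ n → ¬ (i ∈ A × j ∈ A))

SG : (n k : ℕ) → Graph
SG n k = Induced (KG n k) (λ A → Stable (value A))

SymmetricShift : (m : ℕ) → Graph
SymmetricShift m = record
  { Vertex  = [ p ∈ Fin m × Fin m ∣ proj₁ p ≢ proj₂ p ]
  ; Adj     = λ u v → adj (value u) (value v)
  ; Adj-sym = λ where
      (inj₁ j≡k) → inj₂ (sym j≡k)
      (inj₂ i≡l) → inj₁ (sym i≡l)
  }
  where
  adj : Fin m × Fin m → Fin m × Fin m → Set
  adj (i , j) (k , l) = j ≡ k ⊎ i ≡ l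

{-# OPTIONS --safe #-}
module Submission where

-- Schrijver graphs: a stable k-subset A of the (2k + 2)-cycle is determined by the two positions i with
-- i , i + 1 ∉ A, and an explicit assignment reading only the first five bits of A is a homomorphism.
--
-- Kneser graphs: for an antisymmetric sign map on the nonzero vectors of {+,-,0}ⁿ, the number of maximal chains
-- with any prescribed sequence of signs is odd (a form of Fan's lemma).  Given a homomorphism to S₄, colour each
-- k-set by the first coordinate of its image, and let the sign of X say which of X⁺ , X⁻ contains the k-set of
-- largest colour.  Counting alternating chains then yields, as in Chen's theorem on Kneser colourings, disjoint
-- (k - 1)-sets S , T and a bijective labelling π of the four other elements such that S ∪ {x} and T ∪ {x} both
-- have colour π x.  The 12 edges between S ∪ {x} and T ∪ {y}, x ≠ y, each use up the second coordinate of one of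
-- only 8 vertices, which is impossible.

open import Defs
open import Algebra.Bundles using (CommutativeRing)
open import Algebra.Properties.CommutativeSemigroup using (interchange)
open import Data.Bool using (Bool; true; false; not; T; _∧_; _xor_)
open import Data.Bool.Properties using (¬-not; ∧-comm; ∧-assoc; ∧-zeroʳ; ∧-distribˡ-xor; ∧-distribʳ-xor; not-involutive; xor-annihilates-not; xor-assoc; xor-comm; xor-identityʳ; xor-same; xor-∧-commutativeRing)
import Data.Bool.Properties as Bool
open import Data.Empty using (⊥; ⊥-elim-irr)
open import Data.Fin using (Fin; zero; suc; toℕ)
import Data.Fin as Fin
open import Data.Fin.Patterns using (0F; 1F; 2F; 3F)
open import Data.Fin.Properties using (_≟_; _≤?_; all?; toℕ-injective; toℕ<n)
open import Data.Fin.Subset using (Subset; Empty; _∈_; _∉_; _∩_; _∪_; _⊆_; ∣_∣; ⁅_⁆) renaming (⊥ to ∅)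
open import Data.Fin.Subset.Properties using (⊥⊆; ∉⊥; p⊆q⇒∣p∣≤∣q∣; drop-∷-⊆; p⊆p∪q; q⊆p∪q; ∣⊥∣≡0; ∣⁅x⁆∣≡1; x∈p∩q⁺; x∈p∩q⁻; x∈⁅y⁆⇒x≡y; anySubset?; nonempty?)
open import Data.Irrelevant using ([_])
open import Data.Maybe using (Maybe; just; nothing; fromMaybe)
import Data.Maybe as Maybe
open import Data.Nat using (ℕ; zero; suc; _+_; _*_; _≤_; _<_; _<ᵇ_; _⊔_; z≤n; s≤s)
open import Data.Nat.Properties using (≤-refl; ≤-trans; ≤-reflexive; ≤-pred; <-≤-trans; ≤-<-trans; <-irrefl; ≰⇒>; ≮⇒≥; ≤∧≢⇒<; n≤1+n; m≤m+n; m≤m⊔n; m≤n⊔m; ⊔-sel; <ᵇ⇒<; <⇒<ᵇ; suc-injective; +-suc; +-comm; +-identityʳ; +-mono-≤; +-monoʳ-≤; +-cancelʳ-≡; +-cancelʳ-≤; *-comm) renaming (_≤?_ to _≤ℕ?_; _≟_ to _≟ℕ_)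
open import Data.Product using (_×_; _,_; ∃-syntax; Σ-syntax; proj₁; proj₂)
open import Data.Refinement using (_,_) renaming (value to element)
open import Data.Sum using (_⊎_; inj₁; inj₂)
open import Data.Unit using (tt)
open import Data.Vec using (Vec; []; _∷_; _++_; head; take; lookup; replicate; here; there)
import Data.Vec as Vec
open import Function using (_∘_; id)
open import Relation.Binary.PropositionalEquality using (_≡_; _≢_; refl; sym; trans; cong; cong₂; subst; subst₂; module ≡-Reasoning)
open import Relation.Nullary using (¬_; Dec; yes; no; contradiction; ¬?; recompute; _→-dec_; _×-dec_; _⊎-dec_)
open import Relation.Nullary.Decidable using (from-yes; from-no; decidable-stable)

open ≡-Reasoning


-- Sign vectors, boundaries modulo 2 and a parity form of Fan's lemma

SignVector : ℕ → Set
SignVector = Vec (Maybe Bool)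

opp : ∀ {n} → SignVector n → SignVector n
opp = Vec.map (Maybe.map not)

opp-involutive : ∀ {n} (X : SignVector n) → opp (opp X) ≡ X
opp-involutive [] = refl
opp-involutive (nothing ∷ X) = cong (nothing ∷_) (opp-involutive X)
opp-involutive (just b ∷ X) = cong₂ (λ c Y → just c ∷ Y) (not-involutive b) (opp-involutive X)

isZero : ∀ {n} → SignVector n → Bool
isZero [] = true
isZero (nothing ∷ X) = isZero X
isZero (just _ ∷ X) = false

isZero-opp : ∀ {n} (X : SignVector n) → isZero (opp X) ≡ isZero X
isZero-opp [] = refl
isZero-opp (nothing ∷ X) = isZero-opp X
isZero-opp (just _ ∷ X) = refl

xor-interchange : ∀ a b c d → (a xor b) xor (c xor d) ≡ (a xor c) xor (b xor d)
xor-interchange = interchange (CommutativeRing.+-commutativeSemigroup xor-∧-commutativeRing)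

xor-cancel : ∀ a b c → (a xor b) xor (a xor c) ≡ b xor c
xor-cancel false b c = refl
xor-cancel true b c = xor-annihilates-not b c

xor≡false⇒≡ : ∀ a b → a xor b ≡ false → a ≡ b
xor≡false⇒≡ false false _ = refl
xor≡false⇒≡ true true _ = refl

-- Sum modulo 2 over the vectors obtained by zeroing one nonzero entry.
∂ : ∀ {n} → (SignVector n → Bool) → SignVector n → Bool
∂ f [] = false
∂ f (nothing ∷ X) = ∂ (λ Y → f (nothing ∷ Y)) X
∂ f (just b ∷ X) = f (nothing ∷ X) xor ∂ (λ Y → f (just b ∷ Y)) X

∂-cong : ∀ {n} {f g : SignVector n → Bool} → (∀ X → f X ≡ g X) → ∀ X → ∂ f X ≡ ∂ g X
∂-cong eq [] = refl
∂-cong eq (nothing ∷ X) = ∂-cong (λ Y → eq (nothing ∷ Y)) X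
∂-cong eq (just b ∷ X) = cong₂ _xor_ (eq (nothing ∷ X)) (∂-cong (λ Y → eq (just b ∷ Y)) X)

∂-xor : ∀ {n} (f g : SignVector n → Bool) X → ∂ (λ Y → f Y xor g Y) X ≡ ∂ f X xor ∂ g X
∂-xor f g [] = refl
∂-xor f g (nothing ∷ X) = ∂-xor (λ Y → f (nothing ∷ Y)) (λ Y → g (nothing ∷ Y)) X
∂-xor f g (just b ∷ X) = trans
  (cong ((f (nothing ∷ X) xor g (nothing ∷ X)) xor_) (∂-xor (λ Y → f (just b ∷ Y)) (λ Y → g (just b ∷ Y)) X))
  (xor-interchange (f (nothing ∷ X)) (g (nothing ∷ X)) _ _)

-- Two entries can be zeroed in either order, so every term occurs twice. In the recursion the two
-- copies are `∂ f₀ X`, with the head zeroed first or second.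
∂∂≡false : ∀ {n} (f : SignVector n → Bool) X → ∂ (∂ f) X ≡ false
∂∂≡false f [] = refl
∂∂≡false f (nothing ∷ X) = ∂∂≡false (λ Y → f (nothing ∷ Y)) X
∂∂≡false f (just b ∷ X) = begin
  ∂ f₀ X xor ∂ (λ Y → f₀ Y xor ∂ f₁ Y) X  ≡⟨ cong (∂ f₀ X xor_) (∂-xor f₀ (∂ f₁) X) ⟩
  ∂ f₀ X xor (∂ f₀ X xor ∂ (∂ f₁) X)      ≡⟨ xor-assoc (∂ f₀ X) (∂ f₀ X) _ ⟨
  (∂ f₀ X xor ∂ f₀ X) xor ∂ (∂ f₁) X      ≡⟨ cong₂ _xor_ (xor-same (∂ f₀ X)) (∂∂≡false f₁ X) ⟩
  false                                   ∎
  where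
  f₀ = λ Y → f (nothing ∷ Y)
  f₁ = λ Y → f (just b ∷ Y)

∂-opp : ∀ {n} (f : SignVector n → Bool) X → ∂ f (opp X) ≡ ∂ (λ Y → f (opp Y)) X
∂-opp f [] = refl
∂-opp f (nothing ∷ X) = ∂-opp (λ Y → f (nothing ∷ Y)) X
∂-opp f (just b ∷ X) = cong (f (nothing ∷ opp X) xor_) (∂-opp (λ Y → f (just (not b) ∷ Y)) X)

∂-zero : ∀ {n} (f : SignVector n → Bool) X → isZero X ≡ true → ∂ f X ≡ false
∂-zero f [] z = refl
∂-zero f (nothing ∷ X) z = ∂-zero (λ Y → f (nothing ∷ Y)) X z

agree : Bool → Bool → Bool
agree a b = not (a xor b)

agree-not : ∀ a b → agree (not a) b ≡ agree a (not b)
agree-not false b = refl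
agree-not true b = sym (not-involutive (not b))

agree-split : ∀ a b c → (agree a b ∧ c) xor (agree a (not b) ∧ c) ≡ c
agree-split false false c = xor-identityʳ c
agree-split false true c = refl
agree-split true false c = refl
agree-split true true c = xor-identityʳ c

agree⇒≡ : ∀ a b → agree a b ≡ true → a ≡ b
agree⇒≡ false false _ = refl
agree⇒≡ true true _ = refl

-- The parity of the number of chains 0 ⋖ X₁ ⋖ ⋯ ⋖ Xᵢ = X whose signs
-- s Xᵢ, …, s X₁ are the prescribed ones, listed from the top down.
chains : ∀ {n i} → (SignVector n → Bool) → Vec Bool i → SignVector n → Bool
chains s [] X = isZero X
chains s (σ ∷ σs) X = agree (s X) σ ∧ ∂ (chains s σs) X

mutual
  -- By `chains-xor-chains-not` the two counts differ by a boundary, which a second `∂` kills; the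
  -- mutual recursion descends along the sign list.
  ∂-chains-not : ∀ {n i} (s : SignVector n → Bool) (σs : Vec Bool i) X →
                 ∂ (chains s (Vec.map not σs)) X ≡ ∂ (chains s σs) X
  ∂-chains-not s [] X = refl
  ∂-chains-not s (σ ∷ σs) X = sym (xor≡false⇒≡ _ _ (begin
    ∂ (chains s (σ ∷ σs)) X xor ∂ (chains s (Vec.map not (σ ∷ σs))) X
      ≡⟨ ∂-xor (chains s (σ ∷ σs)) (chains s (Vec.map not (σ ∷ σs))) X ⟨
    ∂ (λ Y → chains s (σ ∷ σs) Y xor chains s (Vec.map not (σ ∷ σs)) Y) X
      ≡⟨ ∂-cong (chains-xor-chains-not s σ σs) X ⟩
    ∂ (∂ (chains s σs)) X
      ≡⟨ ∂∂≡false (chains s σs) X ⟩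
    false ∎))

  -- The sign of `X` matches exactly one of `σ` and `not σ`, and the counts below `X` agree by
  -- `∂-chains-not`, so exactly one of the two terms contributes this common count.
  chains-xor-chains-not : ∀ {n i} (s : SignVector n → Bool) σ (σs : Vec Bool i) X →
    chains s (σ ∷ σs) X xor chains s (Vec.map not (σ ∷ σs)) X ≡ ∂ (chains s σs) X
  chains-xor-chains-not s σ σs X = begin
    (agree (s X) σ ∧ ∂ (chains s σs) X) xor (agree (s X) (not σ) ∧ ∂ (chains s (Vec.map not σs)) X)
      ≡⟨ cong (λ c → (agree (s X) σ ∧ ∂ (chains s σs) X) xor (agree (s X) (not σ) ∧ c)) (∂-chains-not s σs X) ⟩
    (agree (s X) σ ∧ ∂ (chains s σs) X) xor (agree (s X) (not σ) ∧ ∂ (chains s σs) X)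
      ≡⟨ agree-split (s X) σ _ ⟩
    ∂ (chains s σs) X ∎

-- The zero vector is its own opposite, so no sign map satisfies the equation there.
Antisymmetric : ∀ {n} → (SignVector n → Bool) → Set
Antisymmetric s = ∀ X → isZero X ≡ false → s (opp X) ≡ not (s X)

chains-opp : ∀ {n i} {s : SignVector n → Bool} → Antisymmetric s → (σs : Vec Bool i) → ∀ X →
             chains s σs (opp X) ≡ chains s (Vec.map not σs) X
chains-opp anti [] X = isZero-opp X
chains-opp {s = s} anti (σ ∷ σs) X = begin
  agree (s (opp X)) σ ∧ ∂ (chains s σs) (opp X)
    ≡⟨ cong (agree (s (opp X)) σ ∧_) (∂-opp (chains s σs) X) ⟩
  agree (s (opp X)) σ ∧ ∂ (λ Y → chains s σs (opp Y)) X
    ≡⟨ cong (agree (s (opp X)) σ ∧_) (∂-cong (chains-opp anti σs) X) ⟩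
  agree (s (opp X)) σ ∧ ∂ (chains s (Vec.map not σs)) X
    ≡⟨ flip-sign (isZero X) refl ⟩
  agree (s X) (not σ) ∧ ∂ (chains s (Vec.map not σs)) X ∎
  where
  flip-sign : ∀ z → isZero X ≡ z →
    agree (s (opp X)) σ ∧ ∂ (chains s (Vec.map not σs)) X ≡ agree (s X) (not σ) ∧ ∂ (chains s (Vec.map not σs)) X
  flip-sign false z = cong (_∧ ∂ (chains s (Vec.map not σs)) X)
    (trans (cong (λ a → agree a σ) (anti X z)) (agree-not (s X) σ))
  -- Antisymmetry says nothing at the zero vector, but nothing lies below it, so both sides are
  -- false.
  flip-sign true z rewrite ∂-zero (chains s (Vec.map not σs)) X z =
    trans (∧-zeroʳ (agree (s (opp X)) σ)) (sym (∧-zeroʳ (agree (s X) (not σ))))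

sumTopes : ∀ {n} → (SignVector n → Bool) → Bool
sumTopes {zero} f = f []
sumTopes {suc n} f = sumTopes (λ X → f (just true ∷ X)) xor sumTopes (λ X → f (just false ∷ X))

isTope : ∀ {n} → SignVector n → Bool
isTope [] = true
isTope (nothing ∷ X) = false
isTope (just _ ∷ X) = isTope X

sumTopes-cong : ∀ {n} {f g : SignVector n → Bool} → (∀ X → isTope X ≡ true → f X ≡ g X) →
                sumTopes f ≡ sumTopes g
sumTopes-cong {zero} eq = eq [] refl
sumTopes-cong {suc n} eq =
  cong₂ _xor_ (sumTopes-cong (λ X → eq (just true ∷ X))) (sumTopes-cong (λ X → eq (just false ∷ X)))

sumTopes-xor : ∀ {n} (f g : SignVector n → Bool) →
               sumTopes (λ X → f X xor g X) ≡ sumTopes f xor sumTopes g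
sumTopes-xor {zero} f g = refl
sumTopes-xor {suc n} f g = trans
  (cong₂ _xor_ (sumTopes-xor (λ X → f (just true ∷ X)) (λ X → g (just true ∷ X)))
               (sumTopes-xor (λ X → f (just false ∷ X)) (λ X → g (just false ∷ X))))
  (xor-interchange (sumTopes (λ X → f (just true ∷ X))) _ _ _)

sumTopes-opp : ∀ {n} (f : SignVector n → Bool) → sumTopes (λ X → f (opp X)) ≡ sumTopes f
sumTopes-opp {zero} f = refl
sumTopes-opp {suc n} f = trans
  (cong₂ _xor_ (sumTopes-opp (λ X → f (just false ∷ X))) (sumTopes-opp (λ X → f (just true ∷ X))))
  (xor-comm (sumTopes (λ X → f (just false ∷ X))) _)

-- A vector with a single zero entry lies below exactly two topes, so its value is counted twice.
sumTopes-∂ : ∀ {n} (f : SignVector n → Bool) → sumTopes (∂ f) ≡ false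
sumTopes-∂ {zero} f = refl
sumTopes-∂ {suc n} f = begin
  sumTopes (λ X → f₀ X xor ∂ (f± true) X) xor sumTopes (λ X → f₀ X xor ∂ (f± false) X)
    ≡⟨ cong₂ _xor_ (sumTopes-xor f₀ (∂ (f± true))) (sumTopes-xor f₀ (∂ (f± false))) ⟩
  (sumTopes f₀ xor sumTopes (∂ (f± true))) xor (sumTopes f₀ xor sumTopes (∂ (f± false)))
    ≡⟨ xor-cancel (sumTopes f₀) _ _ ⟩
  sumTopes (∂ (f± true)) xor sumTopes (∂ (f± false))
    ≡⟨ cong₂ _xor_ (sumTopes-∂ (f± true)) (sumTopes-∂ (f± false)) ⟩
  false ∎
  where
  f₀ = λ X → f (nothing ∷ X)
  f± = λ b X → f (just b ∷ X)

chains-nothing : ∀ {n i} (s : SignVector (suc n) → Bool) (σs : Vec Bool i) X →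
                 chains s σs (nothing ∷ X) ≡ chains (λ Y → s (nothing ∷ Y)) σs X
chains-nothing s [] X = refl
chains-nothing s (σ ∷ σs) X = cong (agree (s (nothing ∷ X)) σ ∧_) (∂-cong (chains-nothing s σs) X)

-- Induction on the dimension. The antipodal map turns chains ending in the negative hemisphere into
-- chains with negated signs ending in the positive one. Together the two families count a boundary,
-- and summed over a hemisphere a boundary leaves only the equator, where the first entry is zero.
maximal-chains-odd : ∀ {n} (s : SignVector n → Bool) → Antisymmetric s → (σs : Vec Bool n) →
                     sumTopes (chains s σs) ≡ true
maximal-chains-odd s anti [] = refl
maximal-chains-odd s anti (σ ∷ σs) = begin
  sumTopes P⁺ xor sumTopes (λ X → chains s (σ ∷ σs) (just false ∷ X))
    ≡⟨ cong (sumTopes P⁺ xor_) (sumTopes-opp (λ X → chains s (σ ∷ σs) (just false ∷ X))) ⟨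
  sumTopes P⁺ xor sumTopes (λ X → chains s (σ ∷ σs) (opp (just true ∷ X)))
    ≡⟨ cong (sumTopes P⁺ xor_) (sumTopes-cong (λ X _ → chains-opp anti (σ ∷ σs) (just true ∷ X))) ⟩
  sumTopes P⁺ xor sumTopes (λ X → chains s (Vec.map not (σ ∷ σs)) (just true ∷ X))
    ≡⟨ sumTopes-xor P⁺ (λ X → chains s (Vec.map not (σ ∷ σs)) (just true ∷ X)) ⟨
  sumTopes (λ X → P⁺ X xor chains s (Vec.map not (σ ∷ σs)) (just true ∷ X))
    ≡⟨ sumTopes-cong (λ X _ → chains-xor-chains-not s σ σs (just true ∷ X)) ⟩
  -- Unfolding `∂` at `just true ∷ X` separates the equator term from the boundary inside the
  -- hemisphere.
  sumTopes (λ X → chains s σs (nothing ∷ X) xor ∂ (λ Y → chains s σs (just true ∷ Y)) X)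
    ≡⟨ sumTopes-xor (λ X → chains s σs (nothing ∷ X)) (∂ (λ Y → chains s σs (just true ∷ Y))) ⟩
  sumTopes (λ X → chains s σs (nothing ∷ X)) xor sumTopes (∂ (λ Y → chains s σs (just true ∷ Y)))
    ≡⟨ cong₂ _xor_ (sumTopes-cong (λ X _ → chains-nothing s σs X)) (sumTopes-∂ (λ Y → chains s σs (just true ∷ Y))) ⟩
  sumTopes (chains (λ Y → s (nothing ∷ Y)) σs) xor false
    ≡⟨ xor-identityʳ _ ⟩
  sumTopes (chains (λ Y → s (nothing ∷ Y)) σs)
    ≡⟨ maximal-chains-odd (λ Y → s (nothing ∷ Y)) (λ X → anti (nothing ∷ X)) σs ⟩
  true ∎
  where
  P⁺ = λ X → chains s (σ ∷ σs) (just true ∷ X)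

-- Cutting maximal chains at an intermediate level

-- Sum modulo 2 over the vectors obtained by filling one zero entry.
δ : ∀ {n} → (SignVector n → Bool) → SignVector n → Bool
δ f [] = false
δ f (nothing ∷ X) = (f (just true ∷ X) xor f (just false ∷ X)) xor δ (λ Y → f (nothing ∷ Y)) X
δ f (just b ∷ X) = δ (λ Y → f (just b ∷ Y)) X

sumAll : ∀ {n} → (SignVector n → Bool) → Bool
sumAll {zero} f = f []
sumAll {suc n} f = sumAll (λ X → f (nothing ∷ X)) xor
                   (sumAll (λ X → f (just true ∷ X)) xor sumAll (λ X → f (just false ∷ X)))

sumAll-cong : ∀ {n} {f g : SignVector n → Bool} → (∀ X → f X ≡ g X) → sumAll f ≡ sumAll g
sumAll-cong {zero} eq = eq []
sumAll-cong {suc n} eq = cong₂ _xor_ (sumAll-cong (λ X → eq (nothing ∷ X)))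
  (cong₂ _xor_ (sumAll-cong (λ X → eq (just true ∷ X))) (sumAll-cong (λ X → eq (just false ∷ X))))

sumAll-xor : ∀ {n} (f g : SignVector n → Bool) →
             sumAll (λ X → f X xor g X) ≡ sumAll f xor sumAll g
sumAll-xor {zero} f g = refl
sumAll-xor {suc n} f g = begin
  sumAll (λ X → f (nothing ∷ X) xor g (nothing ∷ X)) xor
    (sumAll (λ X → f (just true ∷ X) xor g (just true ∷ X)) xor
     sumAll (λ X → f (just false ∷ X) xor g (just false ∷ X)))
    ≡⟨ cong₂ _xor_ (sumAll-xor (λ X → f (nothing ∷ X)) (λ X → g (nothing ∷ X)))
         (cong₂ _xor_ (sumAll-xor (λ X → f (just true ∷ X)) (λ X → g (just true ∷ X)))
                      (sumAll-xor (λ X → f (just false ∷ X)) (λ X → g (just false ∷ X)))) ⟩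
  (f₀ xor g₀) xor ((f₊ xor g₊) xor (f₋ xor g₋))
    ≡⟨ cong ((f₀ xor g₀) xor_) (xor-interchange f₊ g₊ f₋ g₋) ⟩
  (f₀ xor g₀) xor ((f₊ xor f₋) xor (g₊ xor g₋))
    ≡⟨ xor-interchange f₀ g₀ (f₊ xor f₋) (g₊ xor g₋) ⟩
  (f₀ xor (f₊ xor f₋)) xor (g₀ xor (g₊ xor g₋)) ∎
  where
  f₀ = sumAll (λ X → f (nothing ∷ X))
  f₊ = sumAll (λ X → f (just true ∷ X))
  f₋ = sumAll (λ X → f (just false ∷ X))
  g₀ = sumAll (λ X → g (nothing ∷ X))
  g₊ = sumAll (λ X → g (just true ∷ X))
  g₋ = sumAll (λ X → g (just false ∷ X))

sumAll-false : ∀ {n} → sumAll {n} (λ _ → false) ≡ false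
sumAll-false {zero} = refl
sumAll-false {suc n} = cong₂ _xor_ (sumAll-false {n}) (cong₂ _xor_ (sumAll-false {n}) (sumAll-false {n}))

sumAll-witness : ∀ {n} (f : SignVector n → Bool) → sumAll f ≡ true → ∃[ X ] f X ≡ true
sumAll-witness {zero} f eq = [] , eq
sumAll-witness {suc n} f eq
  with sumAll (λ X → f (nothing ∷ X)) in eq₀ | sumAll (λ X → f (just true ∷ X)) in eq₊
... | true  | _     = let X , p = sumAll-witness _ eq₀ in nothing ∷ X , p
... | false | true  = let X , p = sumAll-witness _ eq₊ in just true ∷ X , p
... | false | false = let X , p = sumAll-witness _ eq in just false ∷ X , p

sumTopes≡sumAll : ∀ {n} (f : SignVector n → Bool) → sumTopes f ≡ sumAll (λ X → f X ∧ isTope X)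
sumTopes≡sumAll {zero} f = ∧-comm true (f [])
sumTopes≡sumAll {suc n} f = trans
  (cong₂ _xor_ (sumTopes≡sumAll (λ X → f (just true ∷ X))) (sumTopes≡sumAll (λ X → f (just false ∷ X))))
  (cong₂ _xor_ (sym (trans (sumAll-cong (λ X → ∧-zeroʳ (f (nothing ∷ X)))) (sumAll-false {n}))) refl)

sumAll-isZero : ∀ {n} (f : SignVector n → Bool) → sumAll (λ X → isZero X ∧ f X) ≡ f (replicate n nothing)
sumAll-isZero {zero} f = refl
sumAll-isZero {suc n} f = trans
  (cong₂ _xor_ (sumAll-isZero (λ X → f (nothing ∷ X))) (cong₂ _xor_ (sumAll-false {n}) (sumAll-false {n})))
  (xor-identityʳ _)

-- Both sides sum `f Y ∧ g X` over all pairs where `Y` arises from `X` by zeroing one entry. The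
-- recursion sorts the pairs by the head: zero in both (`u`), zeroed in passing to `Y` (`v`), or
-- kept with its sign (`w`).
∂-δ-adjoint : ∀ {n} (f g : SignVector n → Bool) →
              sumAll (λ X → ∂ f X ∧ g X) ≡ sumAll (λ X → f X ∧ δ g X)
∂-δ-adjoint {zero} f g = sym (∧-zeroʳ (f []))
∂-δ-adjoint {suc n} f g = begin
  sumAll (λ X → ∂ f₀ X ∧ g₀ X) xor (half true xor half false)
    ≡⟨ cong₂ _xor_ (∂-δ-adjoint f₀ g₀) (cong₂ _xor_ (split true) (split false)) ⟩
  u xor ((v true xor w true) xor (v false xor w false))
    ≡⟨ cong (u xor_) (xor-interchange (v true) (w true) (v false) (w false)) ⟩
  u xor ((v true xor v false) xor (w true xor w false))
    ≡⟨ xor-assoc u (v true xor v false) _ ⟨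
  (u xor (v true xor v false)) xor (w true xor w false)
    ≡⟨ cong (_xor (w true xor w false)) (xor-comm u (v true xor v false)) ⟩
  ((v true xor v false) xor u) xor (w true xor w false)
    ≡⟨ cong (λ t → (t xor u) xor (w true xor w false)) (sumAll-xor (λ X → f₀ X ∧ g± true X) (λ X → f₀ X ∧ g± false X)) ⟨
  (sumAll (λ X → (f₀ X ∧ g± true X) xor (f₀ X ∧ g± false X)) xor u) xor (w true xor w false)
    ≡⟨ cong (_xor (w true xor w false)) (sumAll-xor (λ X → (f₀ X ∧ g± true X) xor (f₀ X ∧ g± false X)) (λ X → f₀ X ∧ δ g₀ X)) ⟨
  sumAll (λ X → ((f₀ X ∧ g± true X) xor (f₀ X ∧ g± false X)) xor (f₀ X ∧ δ g₀ X)) xor (w true xor w false)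
    ≡⟨ cong (_xor (w true xor w false)) (sumAll-cong factor) ⟩
  sumAll (λ X → f₀ X ∧ ((g± true X xor g± false X) xor δ g₀ X)) xor (w true xor w false) ∎
  where
  f₀ = λ X → f (nothing ∷ X)
  g₀ = λ X → g (nothing ∷ X)
  f± = λ b X → f (just b ∷ X)
  g± = λ b X → g (just b ∷ X)
  half = λ b → sumAll (λ X → (f₀ X xor ∂ (f± b) X) ∧ g± b X)
  u = sumAll (λ X → f₀ X ∧ δ g₀ X)
  v = λ b → sumAll (λ X → f₀ X ∧ g± b X)
  w = λ b → sumAll (λ X → f± b X ∧ δ (g± b) X)

  split : ∀ b → half b ≡ v b xor w b
  split b = begin
    half b
      ≡⟨ sumAll-cong (λ X → ∧-distribʳ-xor (g± b X) (f₀ X) (∂ (f± b) X)) ⟩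
    sumAll (λ X → (f₀ X ∧ g± b X) xor (∂ (f± b) X ∧ g± b X))
      ≡⟨ sumAll-xor (λ X → f₀ X ∧ g± b X) (λ X → ∂ (f± b) X ∧ g± b X) ⟩
    v b xor sumAll (λ X → ∂ (f± b) X ∧ g± b X)
      ≡⟨ cong (v b xor_) (∂-δ-adjoint (f± b) (g± b)) ⟩
    v b xor w b ∎

  factor : ∀ X → ((f₀ X ∧ g± true X) xor (f₀ X ∧ g± false X)) xor (f₀ X ∧ δ g₀ X)
                 ≡ f₀ X ∧ ((g± true X xor g± false X) xor δ g₀ X)
  factor X = sym (trans (∧-distribˡ-xor (f₀ X) (g± true X xor g± false X) (δ g₀ X))
                        (cong (_xor (f₀ X ∧ δ g₀ X)) (∧-distribˡ-xor (f₀ X) (g± true X) (g± false X))))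

-- The parity of the number of chains X ⋖ X₁ ⋖ ⋯ ⋖ Xᵢ ending in a tope whose
-- signs s X₁, …, s Xᵢ are the prescribed ones, listed from the bottom up.
cochains : ∀ {n i} → (SignVector n → Bool) → Vec Bool i → SignVector n → Bool
cochains s [] X = isTope X
cochains s (σ ∷ σs) X = δ (λ Y → agree (s Y) σ ∧ cochains s σs Y) X

-- Both sums count the same chains up to a tope, cut at two neighbouring levels: the sign `σ` passes
-- from the lower part to the upper part.
shift-chain : ∀ {n i j} (s : SignVector n → Bool) σ (σs : Vec Bool i) (ρs : Vec Bool j) →
  sumAll (λ X → chains s (σ ∷ σs) X ∧ cochains s ρs X) ≡ sumAll (λ X → chains s σs X ∧ cochains s (σ ∷ ρs) X)
shift-chain s σ σs ρs = trans
  (sumAll-cong (λ X → trans (cong (_∧ cochains s ρs X) (∧-comm (agree (s X) σ) _))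
                            (∧-assoc (∂ (chains s σs) X) (agree (s X) σ) _)))
  (∂-δ-adjoint (chains s σs) (λ Y → agree (s Y) σ ∧ cochains s ρs Y))

-- Chains in the four-dimensional cross-polytope

plusSet minusSet : ∀ {n} → SignVector n → Subset n
plusSet = Vec.map (fromMaybe false)
minusSet X = plusSet (opp X)

∷-⊆ : ∀ {n b} {p q : Subset n} → p ⊆ q → (b ∷ p) ⊆ (b ∷ q)
∷-⊆ p⊆q here = here
∷-⊆ p⊆q (there x∈p) = there (p⊆q x∈p)

false∷-⊆ : ∀ {n b} {p q : Subset n} → p ⊆ q → (false ∷ p) ⊆ (b ∷ q)
false∷-⊆ p⊆q (there x∈p) = there (p⊆q x∈p)

⊆∧∣∣≥⇒≡ : ∀ {n} {p q : Subset n} → p ⊆ q → ∣ q ∣ ≤ ∣ p ∣ → p ≡ q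
⊆∧∣∣≥⇒≡ {p = []} {[]} _ _ = refl
⊆∧∣∣≥⇒≡ {p = false ∷ p} {false ∷ q} p⊆q le = cong (false ∷_) (⊆∧∣∣≥⇒≡ (drop-∷-⊆ p⊆q) le)
⊆∧∣∣≥⇒≡ {p = true ∷ p} {true ∷ q} p⊆q (s≤s le) = cong (true ∷_) (⊆∧∣∣≥⇒≡ (drop-∷-⊆ p⊆q) le)
⊆∧∣∣≥⇒≡ {p = true ∷ p} {false ∷ q} p⊆q le with () ← p⊆q here
⊆∧∣∣≥⇒≡ {p = false ∷ p} {true ∷ q} p⊆q le =
  contradiction (≤-trans le (p⊆q⇒∣p∣≤∣q∣ (drop-∷-⊆ p⊆q))) (<-irrefl refl)

∂-witness : ∀ {n} (f : SignVector n → Bool) X → ∂ f X ≡ true →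
            ∃[ Y ] f Y ≡ true × plusSet Y ⊆ plusSet X × minusSet Y ⊆ minusSet X
∂-witness f (nothing ∷ X) eq =
  let Y , p , Y⁺ , Y⁻ = ∂-witness (λ Y → f (nothing ∷ Y)) X eq in nothing ∷ Y , p , ∷-⊆ Y⁺ , ∷-⊆ Y⁻
∂-witness f (just b ∷ X) eq with f (nothing ∷ X) in eq₀
... | true = nothing ∷ X , eq₀ , false∷-⊆ (λ x∈ → x∈) , false∷-⊆ (λ x∈ → x∈)
... | false =
  let Y , p , Y⁺ , Y⁻ = ∂-witness (λ Y → f (just b ∷ Y)) X eq in just b ∷ Y , p , ∷-⊆ Y⁺ , ∷-⊆ Y⁻

∧-true : ∀ a b → a ∧ b ≡ true → a ≡ true × b ≡ true
∧-true true true refl = refl , refl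

chains-witness : ∀ {n i} (s : SignVector n → Bool) σ (σs : Vec Bool i) X → chains s (σ ∷ σs) X ≡ true →
  s X ≡ σ × (∃[ Y ] chains s σs Y ≡ true × plusSet Y ⊆ plusSet X × minusSet Y ⊆ minusSet X)
chains-witness s σ σs X eq =
  let p , q = ∧-true (agree (s X) σ) (∂ (chains s σs) X) eq in agree⇒≡ (s X) σ p , ∂-witness (chains s σs) X q

Monotone : ∀ {n} → (Subset n → ℕ) → Set
Monotone a = ∀ {p q} → p ⊆ q → a p ≤ a q

-- Different values of `a` force different sets, so the inclusion is proper.
⊆∧<⇒∣∣< : ∀ {n} {a : Subset n → ℕ} → ∀ {p q} → p ⊆ q → a p < a q → ∣ p ∣ < ∣ q ∣
⊆∧<⇒∣∣< {a = a} {p} {q} p⊆q lt with ∣ q ∣ ≤ℕ? ∣ p ∣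
... | no ≰ = ≰⇒> ≰
... | yes le = contradiction lt (<-irrefl (cong a (⊆∧∣∣≥⇒≡ p⊆q le)))

<ᵇ≡true⇒< : ∀ m n → (m <ᵇ n) ≡ true → m < n
<ᵇ≡true⇒< m n eq = <ᵇ⇒< m n (subst T (sym eq) tt)

<ᵇ≡false⇒≥ : ∀ m n → (m <ᵇ n) ≡ false → n ≤ m
<ᵇ≡false⇒≥ m n eq = ≮⇒≥ (λ lt → subst T eq (<⇒<ᵇ lt))

compareSides : ∀ {n} → (a b : Subset n → ℕ) → SignVector n → Bool
compareSides a b X = b (minusSet X) <ᵇ a (plusSet X)

alternating₄ : Vec Bool 4
alternating₄ = false ∷ true ∷ false ∷ true ∷ []

-- Signs are listed from the top, so the chain reads +, -, +, - from the bottom. At each step the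
-- side taking the lead must raise its value while the other side cannot lose any, so it gains an
-- element; each side takes the lead twice.
alternating₄-balanced : ∀ {n} {a b : Subset n → ℕ} → Monotone a → Monotone b → a ∅ ≡ 0 →
  ∀ X → chains (compareSides a b) alternating₄ X ≡ true → 2 ≤ ∣ plusSet X ∣ × 2 ≤ ∣ minusSet X ∣
alternating₄-balanced {n} {a} {b} a-mono b-mono a∅ X₄ eq₄ =
  let s = compareSides a b
      s₄ , X₃ , eq₃ , X₃⁺ , X₃⁻ = chains-witness s false (true ∷ false ∷ true ∷ []) X₄ eq₄
      s₃ , X₂ , eq₂ , X₂⁺ , X₂⁻ = chains-witness s true (false ∷ true ∷ []) X₃ eq₃
      s₂ , X₁ , eq₁ , X₁⁺ , X₁⁻ = chains-witness s false (true ∷ []) X₂ eq₂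
      s₁ , _ = chains-witness s true [] X₁ eq₁
      le₄ = <ᵇ≡false⇒≥ _ _ s₄
      lt₃ = <ᵇ≡true⇒< _ _ s₃
      le₂ = <ᵇ≡false⇒≥ _ _ s₂
      lt₁ = <ᵇ≡true⇒< _ _ s₁
      X₁⁺≥1 = ≤-<-trans z≤n (⊆∧<⇒∣∣< {a = a} {∅} {plusSet X₁} ⊥⊆ (≤-<-trans (≤-reflexive a∅) (≤-<-trans z≤n lt₁)))
      X₂⁺<X₃⁺ = ⊆∧<⇒∣∣< {a = a} X₂⁺ (≤-<-trans le₂ (≤-<-trans (b-mono X₂⁻) lt₃))
      X₁⁻<X₂⁻ = ⊆∧<⇒∣∣< {a = b} X₁⁻ (<-≤-trans lt₁ (≤-trans (a-mono X₁⁺) le₂))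
      X₃⁻<X₄⁻ = ⊆∧<⇒∣∣< {a = b} X₃⁻ (<-≤-trans lt₃ (≤-trans (a-mono X₃⁺) le₄))
  in ≤-trans (s≤s (≤-trans X₁⁺≥1 (p⊆q⇒∣p∣≤∣q∣ X₁⁺))) (≤-trans X₂⁺<X₃⁺ (p⊆q⇒∣p∣≤∣q∣ X₃⁺)) ,
     ≤-trans (s≤s (≤-trans (≤-<-trans z≤n X₁⁻<X₂⁻) (p⊆q⇒∣p∣≤∣q∣ X₂⁻))) X₃⁻<X₄⁻

Colour : Set
Colour = Fin 4

isPair : (u v p q : Colour) → Bool
isPair u v p q = (Dec.does (p ≟ u) ∧ Dec.does (q ≟ v)) xor (Dec.does (q ≟ u) ∧ Dec.does (p ≟ v))

-- When disjoint sets never share a nonzero value, the leading value increases strictly along an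
-- alternating chain. It therefore runs through all four colours in order, the first and third on
-- the plus side and the other two on the minus side.
splitTerm : (p q r s : Colour) → Bool
splitTerm p q r s = isPair 0F 2F p q ∧ isPair 1F 3F r s

-- Below a tope with plus elements `x` and `y`, only subsets of this pair are compared. Storing
-- their four values as numbers turns the chain count into a finite computation.
pairTable : (x y : Fin 4) (e u v w : ℕ) → Subset 4 → ℕ
pairTable x y e u v w A = entry (lookup A x) (lookup A y)
  where
  entry : Bool → Bool → ℕ
  entry false false = e
  entry true false = u
  entry false true = v
  entry true true = w

value : Colour → ℕ
value c = suc (toℕ c)

balancedCount : SignVector 4 → (x y z t : Fin 4) → (e u v w e′ u′ v′ w′ : ℕ) → Bool
balancedCount X x y z t e u v w e′ u′ v′ w′ =
  chains (compareSides (pairTable x y e u v w) (pairTable z t e′ u′ v′ w′)) alternating₄ X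

-- Here `h` and `h′` are the colours of the two whole pairs and `p`, `q`, `r`, `s` those of the
-- singletons. The inequalities come from monotonicity, the disequalities from disjointness.
BalancedCount : SignVector 4 → (x y z t : Fin 4) → Set
BalancedCount X x y z t =
  ∀ h h′ → h ≢ h′ →
  ∀ p → p Fin.≤ h → p ≢ h′ → ∀ q → q Fin.≤ h → q ≢ h′ →
  ∀ r → r Fin.≤ h′ → r ≢ h → r ≢ p → r ≢ q → ∀ s → s Fin.≤ h′ → s ≢ h → s ≢ p → s ≢ q →
  balancedCount X x y z t 0 (value p) (value q) (value h) 0 (value r) (value s) (value h′) ≡ splitTerm p q r s

balancedCount? : ∀ X x y z t → Dec (BalancedCount X x y z t)
balancedCount? X x y z t =
  all? λ h → all? λ h′ → ¬? (h ≟ h′) →-dec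
  all? λ p → (p ≤? h) →-dec (¬? (p ≟ h′) →-dec all? λ q → (q ≤? h) →-dec (¬? (q ≟ h′) →-dec
  all? λ r → (r ≤? h′) →-dec (¬? (r ≟ h) →-dec (¬? (r ≟ p) →-dec (¬? (r ≟ q) →-dec
  all? λ s → (s ≤? h′) →-dec (¬? (s ≟ h) →-dec (¬? (s ≟ p) →-dec (¬? (s ≟ q) →-dec
  (_ Bool.≟ _)))))))))

splitTerms : (f g : Fin 4 → Colour) → SignVector 4 → Bool
splitTerms f g (just true ∷ just true ∷ just false ∷ just false ∷ []) = splitTerm (f 0F) (f 1F) (g 2F) (g 3F)
splitTerms f g (just true ∷ just false ∷ just true ∷ just false ∷ []) = splitTerm (f 0F) (f 2F) (g 1F) (g 3F)
splitTerms f g (just true ∷ just false ∷ just false ∷ just true ∷ []) = splitTerm (f 0F) (f 3F) (g 1F) (g 2F)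
splitTerms f g (just false ∷ just true ∷ just true ∷ just false ∷ []) = splitTerm (f 1F) (f 2F) (g 0F) (g 3F)
splitTerms f g (just false ∷ just true ∷ just false ∷ just true ∷ []) = splitTerm (f 1F) (f 3F) (g 0F) (g 2F)
splitTerms f g (just false ∷ just false ∷ just true ∷ just true ∷ []) = splitTerm (f 2F) (f 3F) (g 0F) (g 1F)
splitTerms f g _ = false

fromFour : (c₀ c₁ c₂ c₃ : Colour) → Fin 4 → Colour
fromFour c₀ c₁ c₂ c₃ 0F = c₀
fromFour c₀ c₁ c₂ c₃ 1F = c₁
fromFour c₀ c₁ c₂ c₃ 2F = c₂
fromFour c₀ c₁ c₂ c₃ 3F = c₃

-- The quantifiers are ordered so that each constraint prunes the exhaustive check early.
Rigid : Set
Rigid =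
  ∀ f₀ g₁ → f₀ ≢ g₁ → ∀ g₂ → f₀ ≢ g₂ → ∀ g₃ → f₀ ≢ g₃ →
  ∀ f₁ → f₁ ≢ g₂ → f₁ ≢ g₃ → ∀ f₂ → f₂ ≢ g₁ → f₂ ≢ g₃ → ∀ f₃ → f₃ ≢ g₁ → f₃ ≢ g₂ →
  ∀ g₀ → f₁ ≢ g₀ → f₂ ≢ g₀ → f₃ ≢ g₀ →
  sumTopes (splitTerms (fromFour f₀ f₁ f₂ f₃) (fromFour g₀ g₁ g₂ g₃)) ≡ true →
  ∀ i → fromFour f₀ f₁ f₂ f₃ i ≡ fromFour g₀ g₁ g₂ g₃ i

rigid? : Dec Rigid
rigid? =
  all? λ f₀ → all? λ g₁ → ¬? (f₀ ≟ g₁) →-dec (all? λ g₂ → ¬? (f₀ ≟ g₂) →-dec (all? λ g₃ → ¬? (f₀ ≟ g₃) →-dec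
  (all? λ f₁ → ¬? (f₁ ≟ g₂) →-dec (¬? (f₁ ≟ g₃) →-dec
  (all? λ f₂ → ¬? (f₂ ≟ g₁) →-dec (¬? (f₂ ≟ g₃) →-dec
  (all? λ f₃ → ¬? (f₃ ≟ g₁) →-dec (¬? (f₃ ≟ g₂) →-dec
  (all? λ g₀ → ¬? (f₁ ≟ g₀) →-dec (¬? (f₂ ≟ g₀) →-dec (¬? (f₃ ≟ g₀) →-dec
  ((_ Bool.≟ _) →-dec (all? λ i → _ ≟ _)))))))))))))

-- Settled by enumeration. The parity is essential: `f = 0,2,0,3` and `g = 1,2,1,3` satisfy every
-- disequality and have nonzero terms, but two of them.
rigid : Rigid
rigid = from-yes rigid?

empty-∩-mono : ∀ {n} {p p′ q q′ : Subset n} → p′ ⊆ p → q′ ⊆ q → Empty (p ∩ q) → Empty (p′ ∩ q′)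
empty-∩-mono {p = p} {p′} {q} {q′} p′⊆p q′⊆q e (x , x∈) =
  let x∈p′ , x∈q′ = x∈p∩q⁻ p′ q′ x∈ in e (x , x∈p∩q⁺ (p′⊆p x∈p′ , q′⊆q x∈q′))

∪-⊆ˡ : ∀ {n} {p q : Subset n} → p ⊆ p ∪ q
∪-⊆ˡ {q = q} = p⊆p∪q q

∪-⊆ʳ : ∀ {n} {p q : Subset n} → q ⊆ p ∪ q
∪-⊆ʳ {p = p} {q} = q⊆p∪q p q

∅-empty : ∀ {n} → Empty (∅ {n})
∅-empty (_ , x∈∅) = ∉⊥ x∈∅

empty-⁅⁆∩⁅⁆ : ∀ {n} {x y : Fin n} → x ≢ y → Empty (⁅ x ⁆ ∩ ⁅ y ⁆)
empty-⁅⁆∩⁅⁆ {x = x} {y} x≢y (z , z∈) =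
  let z∈x , z∈y = x∈p∩q⁻ ⁅ x ⁆ ⁅ y ⁆ z∈ in x≢y (trans (sym (x∈⁅y⁆⇒x≡y x z∈x)) (x∈⁅y⁆⇒x≡y y z∈y))

toColour : ∀ m → 0 < m → m ≤ 4 → ∃[ c ] m ≡ value c
toColour 1 _ _ = 0F , refl
toColour 2 _ _ = 1F , refl
toColour 3 _ _ = 2F , refl
toColour 4 _ _ = 3F , refl
toColour (suc (suc (suc (suc (suc m))))) _ (s≤s (s≤s (s≤s (s≤s ()))))

-- Colour profiles on a four-element set

record Profile (a : Subset 4 → ℕ) : Set where
  field
    mono       : Monotone a
    bounded    : ∀ p → a p ≤ 4
    empty      : a ∅ ≡ 0
    singletons : ∀ x → 0 < a ⁅ x ⁆

  colour : Fin 4 → Colour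
  colour x = proj₁ (toColour (a ⁅ x ⁆) (singletons x) (bounded ⁅ x ⁆))

  value-colour : ∀ x → a ⁅ x ⁆ ≡ value (colour x)
  value-colour x = proj₂ (toColour (a ⁅ x ⁆) (singletons x) (bounded ⁅ x ⁆))

  pair-colour : ∀ x y → ∃[ c ] a (⁅ x ⁆ ∪ ⁅ y ⁆) ≡ value c
  pair-colour x y = toColour _ (<-≤-trans (singletons x) (mono ∪-⊆ˡ)) (bounded _)

module Cube {a b : Subset 4 → ℕ} (A : Profile a) (B : Profile b)
            (separated : ∀ p q → Empty (p ∩ q) → a p ≡ b q → a p ≡ 0) where

  module A = Profile A
  module B = Profile B

  distinct : ∀ {p q c d} → Empty (p ∩ q) → a p ≡ value c → b q ≡ value d → c ≢ d
  distinct {p} {q} e ap bq refl with () ← trans (sym ap) (separated p q e (trans ap (sym bq)))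

  colour-≤ : ∀ {a : Subset 4 → ℕ} {p q c d} → Monotone a → p ⊆ q → a p ≡ value c → a q ≡ value d → c Fin.≤ d
  colour-≤ mono p⊆q ap aq = ≤-pred (subst₂ _≤_ ap aq (mono p⊆q))

  -- The finite check speaks of numbers `value c`, and `transport` replaces them by values of `a`
  -- and `b`. At a concrete tope the result agrees by computation with the chain count for
  -- `compareSides a b`.
  balanced : ∀ X x y z t → BalancedCount X x y z t → Empty ((⁅ x ⁆ ∪ ⁅ y ⁆) ∩ (⁅ z ⁆ ∪ ⁅ t ⁆)) →
    balancedCount X x y z t (a ∅) (a ⁅ x ⁆) (a ⁅ y ⁆) (a (⁅ x ⁆ ∪ ⁅ y ⁆)) (b ∅) (b ⁅ z ⁆) (b ⁅ t ⁆) (b (⁅ z ⁆ ∪ ⁅ t ⁆))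
    ≡ splitTerm (A.colour x) (A.colour y) (B.colour z) (B.colour t)
  balanced X x y z t check disjoint =
    let h , a-xy = A.pair-colour x y
        h′ , b-zt = B.pair-colour z t
        p = A.colour x
        q = A.colour y
        r = B.colour z
        s = B.colour t
        claim = check h h′ (distinct disjoint a-xy b-zt)
          p (colour-≤ A.mono ∪-⊆ˡ (A.value-colour x) a-xy) (distinct (empty-∩-mono ∪-⊆ˡ (λ i → i) disjoint) (A.value-colour x) b-zt)
          q (colour-≤ A.mono ∪-⊆ʳ (A.value-colour y) a-xy) (distinct (empty-∩-mono ∪-⊆ʳ (λ i → i) disjoint) (A.value-colour y) b-zt)
          r (colour-≤ B.mono ∪-⊆ˡ (B.value-colour z) b-zt)
            (distinct (empty-∩-mono (λ i → i) ∪-⊆ˡ disjoint) a-xy (B.value-colour z) ∘ sym)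
            (distinct (empty-∩-mono ∪-⊆ˡ ∪-⊆ˡ disjoint) (A.value-colour x) (B.value-colour z) ∘ sym)
            (distinct (empty-∩-mono ∪-⊆ʳ ∪-⊆ˡ disjoint) (A.value-colour y) (B.value-colour z) ∘ sym)
          s (colour-≤ B.mono ∪-⊆ʳ (B.value-colour t) b-zt)
            (distinct (empty-∩-mono (λ i → i) ∪-⊆ʳ disjoint) a-xy (B.value-colour t) ∘ sym)
            (distinct (empty-∩-mono ∪-⊆ˡ ∪-⊆ʳ disjoint) (A.value-colour x) (B.value-colour t) ∘ sym)
            (distinct (empty-∩-mono ∪-⊆ʳ ∪-⊆ʳ disjoint) (A.value-colour y) (B.value-colour t) ∘ sym)
    in transport A.empty (A.value-colour x) (A.value-colour y) a-xy B.empty (B.value-colour z) (B.value-colour t) b-zt claim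
    where
    transport : ∀ {e u v w e′ u′ v′ w′ f k l m f′ k′ l′ m′ c} →
      e ≡ f → u ≡ k → v ≡ l → w ≡ m → e′ ≡ f′ → u′ ≡ k′ → v′ ≡ l′ → w′ ≡ m′ →
      balancedCount X x y z t f k l m f′ k′ l′ m′ ≡ c → balancedCount X x y z t e u v w e′ u′ v′ w′ ≡ c
    transport refl refl refl refl refl refl refl refl eq = eq

  unbalanced : ∀ X → ¬ (2 ≤ ∣ plusSet X ∣ × 2 ≤ ∣ minusSet X ∣) →
               chains (compareSides a b) alternating₄ X ≡ false
  unbalanced X ¬bal = ¬-not (λ eq → ¬bal (alternating₄-balanced A.mono B.mono A.empty X eq))

  -- The chains below a tope cancel in pairs unless they come from four
  -- elements whose one-element extensions already carry the four colours.
  chains≡splitTerms : ∀ X → isTope X ≡ true →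
    chains (compareSides a b) alternating₄ X ≡ splitTerms A.colour B.colour X
  chains≡splitTerms X@(just true ∷ just true ∷ just true ∷ just true ∷ []) _ = unbalanced X λ ()
  chains≡splitTerms X@(just true ∷ just true ∷ just true ∷ just false ∷ []) _ = unbalanced X λ where (_ , s≤s ())
  chains≡splitTerms X@(just true ∷ just true ∷ just false ∷ just true ∷ []) _ = unbalanced X λ where (_ , s≤s ())
  chains≡splitTerms X@(just true ∷ just true ∷ just false ∷ just false ∷ []) _ =
    balanced X 0F 1F 2F 3F (from-yes (balancedCount? X 0F 1F 2F 3F)) ∅-empty
  chains≡splitTerms X@(just true ∷ just false ∷ just true ∷ just true ∷ []) _ = unbalanced X λ where (_ , s≤s ())
  chains≡splitTerms X@(just true ∷ just false ∷ just true ∷ just false ∷ []) _ =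
    balanced X 0F 2F 1F 3F (from-yes (balancedCount? X 0F 2F 1F 3F)) ∅-empty
  chains≡splitTerms X@(just true ∷ just false ∷ just false ∷ just true ∷ []) _ =
    balanced X 0F 3F 1F 2F (from-yes (balancedCount? X 0F 3F 1F 2F)) ∅-empty
  chains≡splitTerms X@(just true ∷ just false ∷ just false ∷ just false ∷ []) _ = unbalanced X λ where (s≤s () , _)
  chains≡splitTerms X@(just false ∷ just true ∷ just true ∷ just true ∷ []) _ = unbalanced X λ where (_ , s≤s ())
  chains≡splitTerms X@(just false ∷ just true ∷ just true ∷ just false ∷ []) _ =
    balanced X 1F 2F 0F 3F (from-yes (balancedCount? X 1F 2F 0F 3F)) ∅-empty
  chains≡splitTerms X@(just false ∷ just true ∷ just false ∷ just true ∷ []) _ =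
    balanced X 1F 3F 0F 2F (from-yes (balancedCount? X 1F 3F 0F 2F)) ∅-empty
  chains≡splitTerms X@(just false ∷ just true ∷ just false ∷ just false ∷ []) _ = unbalanced X λ where (s≤s () , _)
  chains≡splitTerms X@(just false ∷ just false ∷ just true ∷ just true ∷ []) _ =
    balanced X 2F 3F 0F 1F (from-yes (balancedCount? X 2F 3F 0F 1F)) ∅-empty
  chains≡splitTerms X@(just false ∷ just false ∷ just true ∷ just false ∷ []) _ = unbalanced X λ where (s≤s () , _)
  chains≡splitTerms X@(just false ∷ just false ∷ just false ∷ just true ∷ []) _ = unbalanced X λ where (s≤s () , _)
  chains≡splitTerms X@(just false ∷ just false ∷ just false ∷ just false ∷ []) _ = unbalanced X λ where (() , _)

  colours-differ : ∀ x y → x ≢ y → A.colour x ≢ B.colour y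
  colours-differ x y x≢y = distinct (empty-⁅⁆∩⁅⁆ x≢y) (A.value-colour x) (B.value-colour y)

  colours-agree : sumTopes (chains (compareSides a b) alternating₄) ≡ true → ∀ x → A.colour x ≡ B.colour x
  colours-agree odd = λ where
      0F → agree-at 0F
      1F → agree-at 1F
      2F → agree-at 2F
      3F → agree-at 3F
    where
    f = A.colour
    g = B.colour
    agree-at = rigid
      (f 0F) (g 1F) (colours-differ _ _ λ ()) (g 2F) (colours-differ _ _ λ ()) (g 3F) (colours-differ _ _ λ ())
      (f 1F) (colours-differ _ _ λ ()) (colours-differ _ _ λ ())
      (f 2F) (colours-differ _ _ λ ()) (colours-differ _ _ λ ())
      (f 3F) (colours-differ _ _ λ ()) (colours-differ _ _ λ ())
      (g 0F) (colours-differ _ _ λ ()) (colours-differ _ _ λ ()) (colours-differ _ _ λ ())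
      (trans (sym (sumTopes-cong chains≡splitTerms)) odd)

-- Links of sign vectors with four zero entries

zeros : ∀ {n} → SignVector n → ℕ
zeros [] = 0
zeros (nothing ∷ X) = suc (zeros X)
zeros (just _ ∷ X) = zeros X

∣plus∣+∣minus∣+zeros : ∀ {n} (X : SignVector n) → ∣ plusSet X ∣ + ∣ minusSet X ∣ + zeros X ≡ n
∣plus∣+∣minus∣+zeros [] = refl
∣plus∣+∣minus∣+zeros (nothing ∷ X) = trans (+-suc _ _) (cong suc (∣plus∣+∣minus∣+zeros X))
∣plus∣+∣minus∣+zeros (just true ∷ X) = cong suc (∣plus∣+∣minus∣+zeros X)
∣plus∣+∣minus∣+zeros (just false ∷ X) =
  trans (cong (_+ zeros X) (+-suc ∣ plusSet X ∣ ∣ minusSet X ∣)) (cong suc (∣plus∣+∣minus∣+zeros X))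

δ-witness : ∀ {n} (f : SignVector n → Bool) X → δ f X ≡ true →
  ∃[ Y ] f Y ≡ true × zeros X ≡ suc (zeros Y) × minusSet X ⊆ minusSet Y
δ-witness f (just b ∷ X) eq =
  let Y , p , z , ⊆⁻ = δ-witness (λ Y → f (just b ∷ Y)) X eq in just b ∷ Y , p , z , ∷-⊆ ⊆⁻
δ-witness f (nothing ∷ X) eq
  with f (just true ∷ X) in eq₊ | f (just false ∷ X) in eq₋
... | true  | _     = just true ∷ X , eq₊ , refl , false∷-⊆ id
... | false | true  = just false ∷ X , eq₋ , refl , false∷-⊆ id
... | false | false =
  let Y , p , z , ⊆⁻ = δ-witness (λ Y → f (nothing ∷ Y)) X eq in nothing ∷ Y , p , cong suc z , ∷-⊆ ⊆⁻

isTope⇒zeros≡0 : ∀ {n} (X : SignVector n) → isTope X ≡ true → zeros X ≡ 0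
isTope⇒zeros≡0 [] _ = refl
isTope⇒zeros≡0 (just _ ∷ X) eq = isTope⇒zeros≡0 X eq

cochains-witness : ∀ {n i} (s : SignVector n → Bool) σ (σs : Vec Bool i) X → cochains s (σ ∷ σs) X ≡ true →
  ∃[ Y ] s Y ≡ σ × cochains s σs Y ≡ true × zeros X ≡ suc (zeros Y) × minusSet X ⊆ minusSet Y
cochains-witness s σ σs X eq =
  let Y , p , rest = δ-witness (λ Y → agree (s Y) σ ∧ cochains s σs Y) X eq
      q , r = ∧-true (agree (s Y) σ) (cochains s σs Y) p
  in Y , agree⇒≡ (s Y) σ q , r , rest

cochains⇒zeros : ∀ {n i} (s : SignVector n → Bool) (σs : Vec Bool i) X → cochains s σs X ≡ true → zeros X ≡ i
cochains⇒zeros s [] X eq = isTope⇒zeros≡0 X eq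
cochains⇒zeros s (σ ∷ σs) X eq =
  let Y , _ , r , z , _ = cochains-witness s σ σs X eq in trans z (cong suc (cochains⇒zeros s σs Y r))

-- Filling an entry always produces a nonzero vector. This matters later because the two sign rules
-- on a link are compared on nonzero vectors only.
δ-cong : ∀ {n} {f g : SignVector n → Bool} → (∀ X → isZero X ≡ false → f X ≡ g X) → ∀ X → δ f X ≡ δ g X
δ-cong eq [] = refl
δ-cong eq (nothing ∷ X) = cong₂ _xor_
  (cong₂ _xor_ (eq (just true ∷ X) refl) (eq (just false ∷ X) refl)) (δ-cong (λ Y → eq (nothing ∷ Y)) X)
δ-cong eq (just b ∷ X) = δ-cong (λ Y _ → eq (just b ∷ Y) refl) X

cochains-cong : ∀ {n i} {s t : SignVector n → Bool} → (∀ X → isZero X ≡ false → s X ≡ t X) →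
                (σs : Vec Bool i) → ∀ X → cochains s σs X ≡ cochains t σs X
cochains-cong eq [] X = refl
cochains-cong eq (σ ∷ σs) X =
  δ-cong (λ Y nz → cong₂ (λ u v → agree u σ ∧ v) (eq Y nz) (cochains-cong eq σs Y)) X

-- Sign vectors of length n with z zero entries, to be filled in.
data Pattern : ℕ → ℕ → Set where
  []   : Pattern 0 0
  sign : ∀ {n z} → Bool → Pattern n z → Pattern (suc n) z
  hole : ∀ {n z} → Pattern n z → Pattern (suc n) (suc z)

fill : ∀ {n z} → Pattern n z → SignVector z → SignVector n
fill [] [] = []
fill (sign b P) v = just b ∷ fill P v
fill (hole P) (x ∷ v) = x ∷ fill P v

toPattern : ∀ {n} (W : SignVector n) → Σ[ P ∈ Pattern n (zeros W) ] fill P (replicate (zeros W) nothing) ≡ W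
toPattern [] = [] , refl
toPattern (nothing ∷ W) = let P , eq = toPattern W in hole P , cong (nothing ∷_) eq
toPattern (just b ∷ W) = let P , eq = toPattern W in sign b P , cong (just b ∷_) eq

δ-fill : ∀ {n z} (P : Pattern n z) (f : SignVector n → Bool) v → δ f (fill P v) ≡ δ (f ∘ fill P) v
δ-fill [] f [] = refl
δ-fill (sign b P) f v = δ-fill P (λ Y → f (just b ∷ Y)) v
δ-fill (hole P) f (nothing ∷ v) =
  cong ((f (just true ∷ fill P v) xor f (just false ∷ fill P v)) xor_) (δ-fill P (λ Y → f (nothing ∷ Y)) v)
δ-fill (hole P) f (just b ∷ v) = δ-fill P (λ Y → f (just b ∷ Y)) v

isTope-fill : ∀ {n z} (P : Pattern n z) v → isTope (fill P v) ≡ isTope v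
isTope-fill [] [] = refl
isTope-fill (sign b P) v = isTope-fill P v
isTope-fill (hole P) (nothing ∷ v) = refl
isTope-fill (hole P) (just _ ∷ v) = isTope-fill P v

cochains-fill : ∀ {n z i} (P : Pattern n z) (s : SignVector n → Bool) (σs : Vec Bool i) v →
                cochains s σs (fill P v) ≡ cochains (s ∘ fill P) σs v
cochains-fill P s [] v = isTope-fill P v
cochains-fill P s (σ ∷ σs) v = trans
  (δ-fill P (λ Y → agree (s Y) σ ∧ cochains s σs Y) v)
  (δ-cong (λ u _ → cong (agree (s (fill P u)) σ ∧_) (cochains-fill P s σs u)) v)

-- One function serves both sides: `g = id` keeps the fixed plus signs and `g = not` the fixed minus
-- signs.
embed : ∀ {n z} → (Bool → Bool) → Pattern n z → Subset z → Subset n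
embed g [] [] = []
embed g (sign b P) p = g b ∷ embed g P p
embed g (hole P) (x ∷ p) = x ∷ embed g P p

plusSet-fill : ∀ {n z} (P : Pattern n z) v → plusSet (fill P v) ≡ embed id P (plusSet v)
plusSet-fill [] [] = refl
plusSet-fill (sign b P) v = cong (b ∷_) (plusSet-fill P v)
plusSet-fill (hole P) (x ∷ v) = cong (_ ∷_) (plusSet-fill P v)

minusSet-fill : ∀ {n z} (P : Pattern n z) v → minusSet (fill P v) ≡ embed not P (minusSet v)
minusSet-fill [] [] = refl
minusSet-fill (sign b P) v = cong (not b ∷_) (minusSet-fill P v)
minusSet-fill (hole P) (x ∷ v) = cong (_ ∷_) (minusSet-fill P v)

∣embed∣ : ∀ {n z} g (P : Pattern n z) p → ∣ embed g P p ∣ ≡ ∣ embed g P ∅ ∣ + ∣ p ∣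
∣embed∣ g [] [] = refl
∣embed∣ g (sign b P) p with g b
... | true = cong suc (∣embed∣ g P p)
... | false = ∣embed∣ g P p
∣embed∣ g (hole P) (true ∷ p) = trans (cong suc (∣embed∣ g P p)) (sym (+-suc _ _))
∣embed∣ g (hole P) (false ∷ p) = ∣embed∣ g P p

embed-mono : ∀ {n z} g (P : Pattern n z) {p q} → p ⊆ q → embed g P p ⊆ embed g P q
embed-mono g [] {[]} {[]} p⊆q = id
embed-mono g (sign b P) p⊆q = ∷-⊆ (embed-mono g P p⊆q)
embed-mono g (hole P) {false ∷ p} {_ ∷ q} p⊆q = false∷-⊆ (embed-mono g P (drop-∷-⊆ p⊆q))
embed-mono g (hole P) {true ∷ p} {false ∷ q} p⊆q with () ← p⊆q here
embed-mono g (hole P) {true ∷ p} {true ∷ q} p⊆q = ∷-⊆ (embed-mono g P (drop-∷-⊆ p⊆q))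

∷-empty : ∀ {n} {p : Subset n} → Empty p → Empty (false ∷ p)
∷-empty e (suc x , there x∈p) = e (x , x∈p)

embed-disjoint : ∀ {n z} (P : Pattern n z) {p q} → Empty (p ∩ q) → Empty (embed id P p ∩ embed not P q)
embed-disjoint [] {[]} {[]} e = e
embed-disjoint (sign true P) e = ∷-empty (embed-disjoint P e)
embed-disjoint (sign false P) e = ∷-empty (embed-disjoint P e)
embed-disjoint (hole P) {true ∷ p} {true ∷ q} e = contradiction (zero , here) e
embed-disjoint (hole P) {true ∷ p} {false ∷ q} e = ∷-empty (embed-disjoint P (λ (x , x∈) → e (suc x , there x∈)))
embed-disjoint (hole P) {false ∷ p} {_ ∷ q} e = ∷-empty (embed-disjoint P (λ (x , x∈) → e (suc x , there x∈)))

-- Largest values over subsets, and the sign rule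

maxBelow : ∀ {n} → (Subset n → ℕ) → Subset n → ℕ
maxBelow f [] = f []
maxBelow f (false ∷ p) = maxBelow (f ∘ (false ∷_)) p
maxBelow f (true ∷ p) = maxBelow (f ∘ (false ∷_)) p ⊔ maxBelow (f ∘ (true ∷_)) p

maxBelow-upper : ∀ {n} (f : Subset n → ℕ) {p q} → q ⊆ p → f q ≤ maxBelow f p
maxBelow-upper f {[]} {[]} _ = ≤-refl
maxBelow-upper f {false ∷ p} {false ∷ q} q⊆p = maxBelow-upper (f ∘ (false ∷_)) (drop-∷-⊆ q⊆p)
maxBelow-upper f {false ∷ p} {true ∷ q} q⊆p with () ← q⊆p here
maxBelow-upper f {true ∷ p} {false ∷ q} q⊆p =
  ≤-trans (maxBelow-upper (f ∘ (false ∷_)) (drop-∷-⊆ q⊆p)) (m≤m⊔n _ _)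
maxBelow-upper f {true ∷ p} {true ∷ q} q⊆p =
  ≤-trans (maxBelow-upper (f ∘ (true ∷_)) (drop-∷-⊆ q⊆p)) (m≤n⊔m (maxBelow (f ∘ (false ∷_)) p) _)

maxBelow-attained : ∀ {n} (f : Subset n → ℕ) p → ∃[ q ] q ⊆ p × maxBelow f p ≡ f q
maxBelow-attained f [] = [] , id , refl
maxBelow-attained f (false ∷ p) =
  let q , q⊆p , eq = maxBelow-attained (f ∘ (false ∷_)) p in false ∷ q , ∷-⊆ q⊆p , eq
maxBelow-attained f (true ∷ p)
  with ⊔-sel (maxBelow (f ∘ (false ∷_)) p) (maxBelow (f ∘ (true ∷_)) p)
... | inj₁ eq = let q , q⊆p , eq′ = maxBelow-attained (f ∘ (false ∷_)) p in
  false ∷ q , false∷-⊆ q⊆p , trans eq eq′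
... | inj₂ eq = let q , q⊆p , eq′ = maxBelow-attained (f ∘ (true ∷_)) p in
  true ∷ q , ∷-⊆ q⊆p , trans eq eq′

maxBelow-mono : ∀ {n} (f : Subset n → ℕ) → Monotone (maxBelow f)
maxBelow-mono f {p} p⊆q = let r , r⊆p , eq = maxBelow-attained f p in
  ≤-trans (≤-reflexive eq) (maxBelow-upper f (p⊆q ∘ r⊆p))

subset-of-size : ∀ {n} k (p : Subset n) → k ≤ ∣ p ∣ → ∃[ q ] q ⊆ p × ∣ q ∣ ≡ k
subset-of-size {n} zero p _ = ∅ , ⊥⊆ , ∣⊥∣≡0 n
subset-of-size (suc k) (true ∷ p) (s≤s k≤) =
  let q , q⊆p , eq = subset-of-size k p k≤ in true ∷ q , ∷-⊆ q⊆p , cong suc eq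
subset-of-size (suc k) (false ∷ p) k≤ =
  let q , q⊆p , eq = subset-of-size (suc k) p k≤ in false ∷ q , ∷-⊆ q⊆p , eq

signOf : (m n : ℕ) (tie : Bool) → Bool
signOf zero zero tie = tie
signOf zero (suc n) tie = false
signOf (suc m) zero tie = true
signOf (suc m) (suc n) tie = signOf m n tie

signOf-swap : ∀ m n tie → signOf n m (not tie) ≡ not (signOf m n tie)
signOf-swap zero zero tie = refl
signOf-swap zero (suc n) tie = refl
signOf-swap (suc m) zero tie = refl
signOf-swap (suc m) (suc n) tie = signOf-swap m n tie

signOf-≢ : ∀ m n tie → m ≢ n → signOf m n tie ≡ (n <ᵇ m)
signOf-≢ zero zero tie m≢n = contradiction refl m≢n
signOf-≢ zero (suc n) tie m≢n = refl
signOf-≢ (suc m) zero tie m≢n = refl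
signOf-≢ (suc m) (suc n) tie m≢n = signOf-≢ m n tie (m≢n ∘ cong suc)

-- Serves as a tie-break: it is antisymmetric on nonzero vectors, so the sign rule stays
-- antisymmetric when both sides have equal maxima.
firstSign : ∀ {n} → SignVector n → Bool
firstSign [] = true
firstSign (nothing ∷ X) = firstSign X
firstSign (just b ∷ X) = b

firstSign-opp : ∀ {n} → Antisymmetric (firstSign {n})
firstSign-opp (nothing ∷ X) nz = firstSign-opp X nz
firstSign-opp (just b ∷ X) nz = refl

nonzero⇒side : ∀ {n} (X : SignVector n) → isZero X ≡ false → 0 < ∣ plusSet X ∣ ⊎ 0 < ∣ minusSet X ∣
nonzero⇒side (nothing ∷ X) nz = nonzero⇒side X nz
nonzero⇒side (just true ∷ X) nz = inj₁ (s≤s z≤n)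
nonzero⇒side (just false ∷ X) nz = inj₂ (s≤s z≤n)

alternating : ∀ i → Vec Bool (i * 2)
alternating zero = []
alternating (suc i) = false ∷ true ∷ alternating i

ascending₄ : Vec Bool 4
ascending₄ = true ∷ false ∷ true ∷ false ∷ []

-- Every maximal chain is cut at its member four levels below the top, by four applications of
-- `shift-chain`; `ascending₄` is the same four signs read upwards.
top-four-signs : ∀ {n i} (s : SignVector n → Bool) (σs : Vec Bool i) →
  sumTopes (chains s (false ∷ true ∷ false ∷ true ∷ σs)) ≡ sumAll (λ X → chains s σs X ∧ cochains s ascending₄ X)
top-four-signs s σs =
  trans (sumTopes≡sumAll (chains s (false ∷ true ∷ false ∷ true ∷ σs)))
  (trans (shift-chain s false (true ∷ false ∷ true ∷ σs) [])
  (trans (shift-chain s true (false ∷ true ∷ σs) (false ∷ []))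
  (trans (shift-chain s false (true ∷ σs) (true ∷ false ∷ []))
         (shift-chain s true σs (false ∷ true ∷ false ∷ [])))))

j*2≡j+j : ∀ j → j * 2 ≡ j + j
j*2≡j+j j = trans (*-comm j 2) (cong (j +_) (+-identityʳ j))

one-side-small : ∀ j x y → x + y ≤ suc (j * 2) → suc j ≤ x → y < suc j
one-side-small j x y le j<x = ≰⇒> λ j<y → <-irrefl refl
  (≤-trans (s≤s (≤-reflexive (trans (cong suc (j*2≡j+j j)) (sym (+-suc j j))))) (≤-trans (+-mono-≤ j<x j<y) le))

both-halves : ∀ j x y → x + y ≡ j * 2 → x < suc j → y < suc j → x ≡ j × y ≡ j
both-halves j x y sum (s≤s x≤j) (s≤s y≤j) = x≡j , y≡j
  where
  x≡j : x ≡ j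
  x≡j with x ≟ℕ j
  ... | yes eq = eq
  ... | no x≢j = contradiction (+-mono-≤ (≤∧≢⇒< x≤j x≢j) y≤j) (<-irrefl (trans sum (j*2≡j+j j)))
  y≡j : y ≡ j
  y≡j with y ≟ℕ j
  ... | yes eq = eq
  ... | no y≢j = contradiction
    (≤-trans (≤-reflexive (sym (+-suc x y))) (+-mono-≤ x≤j (≤∧≢⇒< y≤j y≢j))) (<-irrefl (trans sum (j*2≡j+j j)))

-- Since `π` is injective, `p 0F` accounts for at most one of the three edges at `0F`. Two of the
-- values `q 1F`, `q 2F`, `q 3F` must then equal `π 0F`, and `clash` applies to the remaining index.
no-crown-in-shift : (π p q : Fin 4 → Fin 4) → (∀ x y → x ≢ y → π x ≢ π y) →
                    ¬ (∀ x y → x ≢ y → p x ≡ π y ⊎ π x ≡ q y)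
no-crown-in-shift π p q π-inj adj = cases (adj 0F 1F λ ()) (adj 0F 2F λ ()) (adj 0F 3F λ ())
  where
  -- If q y and q z both equal π 0, the remaining w has p w = π y and p w = π z.
  clash : ∀ w y z → w ≢ 0F → w ≢ y → w ≢ z → y ≢ z → π 0F ≡ q y → π 0F ≡ q z → ⊥
  clash w y z w≢0 w≢y w≢z y≢z qy qz with adj w y w≢y | adj w z w≢z
  ... | inj₂ e  | _       = π-inj w 0F w≢0 (trans e (sym qy))
  ... | inj₁ _  | inj₂ e  = π-inj w 0F w≢0 (trans e (sym qz))
  ... | inj₁ e  | inj₁ e′ = π-inj y z y≢z (trans (sym e) e′)

  cases : p 0F ≡ π 1F ⊎ π 0F ≡ q 1F → p 0F ≡ π 2F ⊎ π 0F ≡ q 2F → p 0F ≡ π 3F ⊎ π 0F ≡ q 3F → ⊥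
  cases (inj₁ e) (inj₁ e′) _ = π-inj 1F 2F (λ ()) (trans (sym e) e′)
  cases (inj₁ e) (inj₂ _) (inj₁ e′) = π-inj 1F 3F (λ ()) (trans (sym e) e′)
  cases (inj₁ _) (inj₂ q₂) (inj₂ q₃) = clash 1F 2F 3F (λ ()) (λ ()) (λ ()) (λ ()) q₂ q₃
  cases (inj₂ q₁) (inj₂ q₂) _ = clash 3F 1F 2F (λ ()) (λ ()) (λ ()) (λ ()) q₁ q₂
  cases (inj₂ _) (inj₁ e) (inj₁ e′) = π-inj 2F 3F (λ ()) (trans (sym e) e′)
  cases (inj₂ q₁) (inj₁ _) (inj₂ q₃) = clash 2F 1F 3F (λ ()) (λ ()) (λ ()) (λ ()) q₁ q₃

-- The Kneser graph

-- With equal first coordinates, either kind of adjacency would make one of the two pairs diagonal.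
-- Hence first coordinates form a proper colouring.
shift-adjacent⇒≢ : ∀ {m} (u v : Vertex (SymmetricShift m)) → Adj (SymmetricShift m) u v →
                   proj₁ (element u) ≢ proj₁ (element v)
shift-adjacent⇒≢ ((i , j) , [ i≢j ]) ((k , l) , [ k≢l ]) (inj₁ j≡k) i≡k = ⊥-elim-irr (i≢j (trans i≡k (sym j≡k)))
shift-adjacent⇒≢ ((i , j) , [ i≢j ]) ((k , l) , [ k≢l ]) (inj₂ i≡l) i≡k = ⊥-elim-irr (k≢l (trans (sym i≡k) i≡l))

module Colouring {n k : ℕ} (hom : Homomorphism (KG n k) (SymmetricShift 4)) where

  open Homomorphism hom

  image : (p : Subset n) → ∣ p ∣ ≡ k → Fin 4 × Fin 4
  image p eq = element (map (p , [ eq ]))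

  colour : Subset n → ℕ
  colour p with ∣ p ∣ ≟ℕ k
  ... | yes eq = value (proj₁ (image p eq))
  -- The colours of vertices start at 1, so 0 marks the absence of a `k`-set and never wins a
  -- maximum against one.
  ... | no _ = 0

  colour-of-vertex : ∀ p (eq : ∣ p ∣ ≡ k) → colour p ≡ value (proj₁ (image p eq))
  colour-of-vertex p eq with ∣ p ∣ ≟ℕ k
  ... | yes _ = refl
  ... | no ≢k = contradiction eq ≢k

  colour-other : ∀ p → ∣ p ∣ ≢ k → colour p ≡ 0
  colour-other p ≢k with ∣ p ∣ ≟ℕ k
  ... | yes eq = contradiction eq ≢k
  ... | no _ = refl

  colour-bounded : ∀ p → colour p ≤ 4
  colour-bounded p with ∣ p ∣ ≟ℕ k
  ... | yes eq = toℕ<n (proj₁ (image p eq))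
  ... | no _ = z≤n

  colour-separated : ∀ p q → Empty (p ∩ q) → colour p ≡ colour q → colour p ≡ 0
  colour-separated p q e with ∣ p ∣ ≟ℕ k | ∣ q ∣ ≟ℕ k
  ... | no _   | _       = λ _ → refl
  ... | yes _  | no _    = id
  ... | yes pk | yes qk  = λ eq → contradiction (toℕ-injective (suc-injective eq))
    (shift-adjacent⇒≢ (map (p , [ pk ])) (map (q , [ qk ])) (preserves e))

  M : Subset n → ℕ
  M = maxBelow colour

  -- The maxima are attained on subsets that are again disjoint, which reduces the claim to
  -- `colour-separated`.
  M-separated : ∀ p q → Empty (p ∩ q) → M p ≡ M q → M p ≡ 0
  M-separated p q e eq =
    let p′ , p′⊆p , Mp = maxBelow-attained colour p
        q′ , q′⊆q , Mq = maxBelow-attained colour q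
    in trans Mp (colour-separated p′ q′ (empty-∩-mono p′⊆p q′⊆q e) (trans (sym Mp) (trans eq Mq)))

  M-bounded : ∀ p → M p ≤ 4
  M-bounded p = let q , _ , eq = maxBelow-attained colour p in ≤-trans (≤-reflexive eq) (colour-bounded q)

  M-small : ∀ p → ∣ p ∣ < k → M p ≡ 0
  M-small p p<k = let q , q⊆p , eq = maxBelow-attained colour p in
    trans eq (colour-other q (λ qk → <-irrefl qk (≤-<-trans (p⊆q⇒∣p∣≤∣q∣ q⊆p) p<k)))

  M-large : ∀ p → k ≤ ∣ p ∣ → 0 < M p
  M-large p k≤p = let q , q⊆p , eq = subset-of-size k p k≤p in
    <-≤-trans (subst (0 <_) (sym (colour-of-vertex q eq)) (s≤s z≤n)) (maxBelow-upper colour q⊆p)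

  -- A positive maximum is attained on a `k`-set, and the only `k`-subset of a `k`-set is the set
  -- itself.
  M-of-vertex : ∀ p (eq : ∣ p ∣ ≡ k) → M p ≡ value (proj₁ (image p eq))
  M-of-vertex p eq = let q , q⊆p , Mp = maxBelow-attained colour p in attained-at q q⊆p Mp (∣ q ∣ ≟ℕ k)
    where
    attained-at : ∀ q → q ⊆ p → M p ≡ colour q → Dec (∣ q ∣ ≡ k) → M p ≡ value (proj₁ (image p eq))
    attained-at q q⊆p Mp (yes qk) =
      trans Mp (trans (cong colour (⊆∧∣∣≥⇒≡ q⊆p (≤-reflexive (trans eq (sym qk))))) (colour-of-vertex p eq))
    attained-at q q⊆p Mp (no ≢k) = contradiction (trans Mp (colour-other q ≢k))
      (λ M≡0 → <-irrefl (sym M≡0) (M-large p (≤-reflexive (sym eq))))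

  -- M vanishes exactly on sets of size below k, so by M-separated the tie-break only
  -- matters when neither side contains a k-set.
  sgn : SignVector n → Bool
  sgn X = signOf (M (plusSet X)) (M (minusSet X)) (firstSign X)

  sgn-opp : Antisymmetric sgn
  sgn-opp X nz rewrite opp-involutive X | firstSign-opp X nz =
    signOf-swap (M (plusSet X)) (M (minusSet X)) (firstSign X)

  sgn-plus : ∀ X → 0 < M (plusSet X) → M (minusSet X) ≡ 0 → sgn X ≡ true
  sgn-plus X pos zer with M (plusSet X) | M (minusSet X)
  sgn-plus X (s≤s _) refl | suc _ | zero = refl

  sgn-minus : ∀ X → M (plusSet X) ≡ 0 → 0 < M (minusSet X) → sgn X ≡ false
  sgn-minus X zer pos with M (plusSet X) | M (minusSet X)
  sgn-minus X refl (s≤s _) | zero | suc _ = refl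

-- The member of a chain four levels below the top

module CriticalVector (j : ℕ) (hom : Homomorphism (KG ((2 + j) * 2) (suc j)) (SymmetricShift 4))
  (W : SignVector ((2 + j) * 2))
  (W-below : chains (Colouring.sgn hom) (alternating j) W ≡ true)
  (W-above : cochains (Colouring.sgn hom) ascending₄ W ≡ true) where

  open Colouring hom

  W-zeros : zeros W ≡ 4
  W-zeros = cochains⇒zeros sgn ascending₄ W W-above

  side-sizes : ∀ (X : SignVector ((2 + j) * 2)) z → zeros X ≡ z → ∣ plusSet X ∣ + ∣ minusSet X ∣ + z ≡ (2 + j) * 2
  side-sizes X z refl = ∣plus∣+∣minus∣+zeros X

  W-sizes : ∣ plusSet W ∣ + ∣ minusSet W ∣ ≡ j * 2
  W-sizes = +-cancelʳ-≡ 4 _ _ (trans (side-sizes W 4 W-zeros) (+-comm 4 (j * 2)))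

  -- A large plus side leaves the minus side too small for a vertex, so `W` would be positive,
  -- whereas the chain below prescribes a negative sign at `W`.
  W-plus-small : ∣ plusSet W ∣ < suc j
  W-plus-small with suc j ≤ℕ? ∣ plusSet W ∣
  ... | no ≰ = ≰⇒> ≰
  ... | yes j<W⁺ = contradiction (sgn-plus W (M-large (plusSet W) j<W⁺) (M-small (minusSet W) W⁻≤j)) (negative j refl)
    where
    W⁻≤j : ∣ minusSet W ∣ < suc j
    W⁻≤j = one-side-small j ∣ plusSet W ∣ ∣ minusSet W ∣ (≤-trans (≤-reflexive W-sizes) (n≤1+n _)) j<W⁺

    negative : ∀ i → i ≡ j → sgn W ≢ true
    -- For `j = 0` no sign is prescribed at `W`, but then `W` is the zero vector and has no large
    -- side.
    negative zero refl _ = contradiction (≤-trans j<W⁺ (≤-trans (m≤m+n _ _) (≤-reflexive W-sizes))) λ ()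
    negative (suc i) refl eq with () ← trans (sym eq) (proj₁ (chains-witness sgn false (true ∷ alternating i) W W-below))

  -- Here the contradiction sits one level up: the next vector `Y` must be positive, but it inherits
  -- the large minus side, and its plus side is too small for a vertex.
  W-minus-small : ∣ minusSet W ∣ < suc j
  W-minus-small with suc j ≤ℕ? ∣ minusSet W ∣
  ... | no ≰ = ≰⇒> ≰
  ... | yes j<W⁻ with cochains-witness sgn true (false ∷ true ∷ false ∷ []) W W-above
  ...   | Y , sgn-Y , _ , z , W⁻⊆Y⁻ = contradiction (trans (sym sgn-Y) (sgn-minus Y (M-small (plusSet Y) Y⁺≤j) (M-large (minusSet Y) j<Y⁻))) λ ()
    where
    j<Y⁻ : suc j ≤ ∣ minusSet Y ∣
    j<Y⁻ = ≤-trans j<W⁻ (p⊆q⇒∣p∣≤∣q∣ W⁻⊆Y⁻)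

    Y-sizes : ∣ plusSet Y ∣ + ∣ minusSet Y ∣ ≡ suc (j * 2)
    Y-sizes = +-cancelʳ-≡ 3 _ _
      (trans (side-sizes Y 3 (suc-injective (trans (sym z) W-zeros))) (cong suc (+-comm 3 (j * 2))))

    Y⁺≤j : ∣ plusSet Y ∣ < suc j
    Y⁺≤j = one-side-small j ∣ minusSet Y ∣ ∣ plusSet Y ∣ (≤-reflexive (trans (+-comm ∣ minusSet Y ∣ _) Y-sizes)) j<Y⁻

  W-halves : ∣ plusSet W ∣ ≡ j × ∣ minusSet W ∣ ≡ j
  W-halves = both-halves j ∣ plusSet W ∣ ∣ minusSet W ∣ W-sizes W-plus-small W-minus-small

-- The link of the critical vector

module CriticalPattern (j : ℕ) (hom : Homomorphism (KG ((2 + j) * 2) (suc j)) (SymmetricShift 4))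
  (P : Pattern ((2 + j) * 2) 4)
  (P⁺-size : ∣ embed id P ∅ ∣ ≡ j) (P⁻-size : ∣ embed not P ∅ ∣ ≡ j)
  (P-above : cochains (Colouring.sgn hom) ascending₄ (fill P (replicate 4 nothing)) ≡ true) where

  open Homomorphism hom
  open Colouring hom

  module Extension (g : Bool → Bool) (base-size : ∣ embed g P ∅ ∣ ≡ j) where

    ∣embed-g∣ : ∀ p → ∣ embed g P p ∣ ≡ j + ∣ p ∣
    ∣embed-g∣ p = trans (∣embed∣ g P p) (cong (_+ ∣ p ∣) base-size)

    positive : ∀ p → 0 < ∣ p ∣ → 0 < M (embed g P p)
    positive p 0<p = M-large (embed g P p) (≤-trans (≤-reflexive (sym (trans (+-suc j 0) (cong suc (+-identityʳ j)))))
      (≤-trans (+-monoʳ-≤ j 0<p) (≤-reflexive (sym (∣embed-g∣ p)))))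

    profile : Profile (M ∘ embed g P)
    profile = record
      { mono       = λ p⊆q → maxBelow-mono colour (embed-mono g P p⊆q)
      ; bounded    = λ p → M-bounded (embed g P p)
      ; empty      = M-small (embed g P ∅) (s≤s (≤-reflexive (trans (∣embed-g∣ ∅) (+-identityʳ j))))
      ; singletons = λ x → positive ⁅ x ⁆ (≤-reflexive (sym (∣⁅x⁆∣≡1 x)))
      }

    vertex-size : ∀ x → ∣ embed g P ⁅ x ⁆ ∣ ≡ suc j
    vertex-size x = trans (∣embed-g∣ ⁅ x ⁆) (trans (cong (j +_) (∣⁅x⁆∣≡1 x)) (+-comm j 1))

    vertex-image : Fin 4 → Fin 4 × Fin 4
    vertex-image x = image (embed g P ⁅ x ⁆) (vertex-size x)

    colour≡proj₁ : ∀ x → Profile.colour profile x ≡ proj₁ (vertex-image x)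
    colour≡proj₁ x = toℕ-injective (suc-injective
      (trans (sym (Profile.value-colour profile x)) (M-of-vertex (embed g P ⁅ x ⁆) (vertex-size x))))

  module E⁺ = Extension id P⁺-size
  module E⁻ = Extension not P⁻-size

  open Cube E⁺.profile E⁻.profile (λ p q e → M-separated (embed id P p) (embed not P q) (embed-disjoint P e))

  -- Filling a hole brings one side to at least `j + 1` elements, so its maximum is positive. By
  -- `M-separated` the two maxima then differ and no tie occurs.
  sgn-fill : ∀ v → isZero v ≡ false →
             sgn (fill P v) ≡ compareSides (M ∘ embed id P) (M ∘ embed not P) v
  sgn-fill v nz = trans
    (cong₂ (λ p q → signOf (M p) (M q) (firstSign (fill P v))) (plusSet-fill P v) (minusSet-fill P v))
    (signOf-≢ (M (embed id P (plusSet v))) (M (embed not P (minusSet v))) (firstSign (fill P v)) λ eq →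
      let M⁺≡0 = M-separated (embed id P (plusSet v)) (embed not P (minusSet v)) (embed-disjoint P (plusSet∩minusSet v)) eq in
      nonzero-sides v nz M⁺≡0 (trans (sym eq) M⁺≡0))
    where
    plusSet∩minusSet : ∀ {m} (X : SignVector m) → Empty (plusSet X ∩ minusSet X)
    plusSet∩minusSet [] (() , _)
    plusSet∩minusSet (nothing ∷ X) = ∷-empty (plusSet∩minusSet X)
    plusSet∩minusSet (just true ∷ X) = ∷-empty (plusSet∩minusSet X)
    plusSet∩minusSet (just false ∷ X) = ∷-empty (plusSet∩minusSet X)

    nonzero-sides : ∀ v → isZero v ≡ false → M (embed id P (plusSet v)) ≡ 0 → M (embed not P (minusSet v)) ≡ 0 → ⊥
    nonzero-sides v nz M⁺≡0 M⁻≡0 with nonzero⇒side v nz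
    ... | inj₁ 0<v⁺ = <-irrefl (sym M⁺≡0) (E⁺.positive (plusSet v) 0<v⁺)
    ... | inj₂ 0<v⁻ = <-irrefl (sym M⁻≡0) (E⁻.positive (minusSet v) 0<v⁻)

  -- Cutting the link's chains four levels below the top means cutting them at the zero vector. What
  -- remains is the parity of chains above the critical vector, transported through `fill`.
  link-odd : sumTopes (chains (compareSides (M ∘ embed id P) (M ∘ embed not P)) alternating₄) ≡ true
  link-odd = begin
    sumTopes (chains s alternating₄)                       ≡⟨ top-four-signs s [] ⟩
    sumAll (λ X → isZero X ∧ cochains s ascending₄ X)      ≡⟨ sumAll-isZero (cochains s ascending₄) ⟩
    cochains s ascending₄ (replicate 4 nothing)            ≡⟨ cochains-cong sgn-fill ascending₄ (replicate 4 nothing) ⟨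
    cochains (sgn ∘ fill P) ascending₄ (replicate 4 nothing) ≡⟨ cochains-fill P sgn ascending₄ (replicate 4 nothing) ⟨
    cochains sgn ascending₄ (fill P (replicate 4 nothing)) ≡⟨ P-above ⟩
    true ∎
    where
    s = compareSides (M ∘ embed id P) (M ∘ embed not P)

  π : Fin 4 → Fin 4
  π = Profile.colour E⁺.profile

  π≡colour⁻ : ∀ x → π x ≡ Profile.colour E⁻.profile x
  π≡colour⁻ = colours-agree link-odd

  π-injective : ∀ x y → x ≢ y → π x ≢ π y
  π-injective x y x≢y eq = colours-differ x y x≢y (trans eq (π≡colour⁻ y))

  image-adjacent : ∀ x y → x ≢ y → proj₂ (E⁺.vertex-image x) ≡ π y ⊎ π x ≡ proj₂ (E⁻.vertex-image y)
  image-adjacent x y x≢y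
    with preserves {embed id P ⁅ x ⁆ , [ E⁺.vertex-size x ]} {embed not P ⁅ y ⁆ , [ E⁻.vertex-size y ]}
                   (embed-disjoint P (empty-⁅⁆∩⁅⁆ x≢y))
  ... | inj₁ e = inj₁ (trans e (trans (sym (E⁻.colour≡proj₁ y)) (sym (π≡colour⁻ y))))
  ... | inj₂ e = inj₂ (trans (E⁺.colour≡proj₁ x) e)

  absurd : ⊥
  absurd = no-crown-in-shift π (proj₂ ∘ E⁺.vertex-image) (proj₂ ∘ E⁻.vertex-image) π-injective image-adjacent

no-KG-homomorphism : ∀ j → ¬ Homomorphism (KG ((2 + j) * 2) (suc j)) (SymmetricShift 4)
no-KG-homomorphism j hom = from-critical (sumAll-witness _
    -- `alternating (2 + j)` unfolds to the four top signs followed by `alternating j`, so the odd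
    -- total has a nonzero term at some critical vector.
    (trans (sym (top-four-signs sgn (alternating j))) (maximal-chains-odd sgn sgn-opp (alternating (2 + j)))))
  where
  open Colouring hom

  from-pattern : ∀ W → cochains sgn ascending₄ W ≡ true → ∣ plusSet W ∣ ≡ j × ∣ minusSet W ∣ ≡ j →
                 Σ[ P ∈ Pattern ((2 + j) * 2) 4 ] fill P (replicate 4 nothing) ≡ W → ⊥
  from-pattern _ above (W⁺ , W⁻) (P , refl) = CriticalPattern.absurd j hom P
    (trans (cong ∣_∣ (sym (plusSet-fill P (replicate 4 nothing)))) W⁺)
    (trans (cong ∣_∣ (sym (minusSet-fill P (replicate 4 nothing)))) W⁻) above

  from-critical : ∃[ W ] chains sgn (alternating j) W ∧ cochains sgn ascending₄ W ≡ true → ⊥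
  from-critical (W , both) =
    let below , above = ∧-true (chains sgn (alternating j) W) (cochains sgn ascending₄ W) both
        open CriticalVector j hom W below above
    in from-pattern W above W-halves
         (subst (λ z → Σ[ P ∈ Pattern ((2 + j) * 2) z ] fill P (replicate z nothing) ≡ W) W-zeros (toPattern W))

-- The Schrijver graph

∣++∣ : ∀ {m n} (p : Subset m) (q : Subset n) → ∣ p ++ q ∣ ≡ ∣ p ∣ + ∣ q ∣
∣++∣ [] q = refl
∣++∣ (true ∷ p) q = cong suc (∣++∣ p q)
∣++∣ (false ∷ p) q = ∣++∣ p q

empty-++ : ∀ {m n} (p : Subset m) (q : Subset n) → Empty (p ++ q) → Empty p
empty-++ (_ ∷ p) q e (zero , here) = e (zero , here)
empty-++ (_ ∷ p) q e (suc x , there x∈p) = empty-++ p q (λ (y , y∈) → e (suc y , there y∈)) (x , x∈p)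

sparse : ∀ {n} → Subset n → Bool
sparse [] = true
sparse (x ∷ []) = true
sparse (x ∷ y ∷ p) = not (x ∧ y) ∧ sparse (y ∷ p)

lastOutside : ∀ {n} → Subset n → Bool
lastOutside [] = true
lastOutside (x ∷ []) = not x
lastOutside (x ∷ y ∷ p) = lastOutside (y ∷ p)

sparse-tail : ∀ {n} x (p : Subset n) → sparse (x ∷ p) ≡ true → sparse p ≡ true
sparse-tail x [] _ = refl
sparse-tail x (y ∷ p) eq = proj₂ (∧-true (not (x ∧ y)) (sparse (y ∷ p)) eq)

lastOutside-tail : ∀ {n} x (p : Subset n) → lastOutside (x ∷ p) ≡ true → lastOutside p ≡ true
lastOutside-tail x [] _ = refl
lastOutside-tail x (y ∷ p) eq = eq

sparse-++ : ∀ {m n} (p : Subset m) (q : Subset n) → sparse (p ++ q) ≡ true → sparse p ≡ true × sparse q ≡ true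
sparse-++ [] q eq = refl , eq
sparse-++ (x ∷ []) q eq = refl , sparse-tail x q eq
sparse-++ (x ∷ y ∷ p) q eq =
  let xy , rest = ∧-true (not (x ∧ y)) (sparse (y ∷ p ++ q)) eq
      yp , sq = sparse-++ (y ∷ p) q rest
  in cong₂ _∧_ xy yp , sq

lastOutside-++ : ∀ {m n} (p : Subset m) (q : Subset n) → lastOutside (p ++ q) ≡ true → lastOutside q ≡ true
lastOutside-++ [] q eq = eq
lastOutside-++ (x ∷ p) q eq = lastOutside-++ p q (lastOutside-tail x (p ++ q) eq)

two-step : ∀ {c d n} → c ≤ suc d → d + d ≤ n → c + c ≤ suc (suc n)
two-step {c} {d} c≤ d≤ = ≤-trans (+-mono-≤ c≤ c≤)
  (≤-trans (≤-reflexive (cong suc (+-suc d d))) (s≤s (s≤s d≤)))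

sparse-two : ∀ {n} x y (p : Subset n) → sparse (x ∷ y ∷ p) ≡ true → ∣ x ∷ y ∷ p ∣ ≤ suc ∣ p ∣
sparse-two false false p _ = n≤1+n _
sparse-two false true p _ = ≤-refl
sparse-two true false p _ = ≤-refl

-- Two neighbouring positions hold at most one element; peeling them off in pairs leaves at most one
-- single position, which explains the extra 1.
sparse-size : ∀ {n} (p : Subset n) → sparse p ≡ true → ∣ p ∣ + ∣ p ∣ ≤ suc n
sparse-size [] _ = z≤n
sparse-size (true ∷ []) _ = ≤-refl
sparse-size (false ∷ []) _ = z≤n
sparse-size (x ∷ y ∷ p) eq =
  two-step (sparse-two x y p eq) (sparse-size p (sparse-tail y p (sparse-tail x (y ∷ p) eq)))

sparse-lastOutside-size : ∀ {n} (p : Subset n) → sparse p ≡ true → lastOutside p ≡ true → ∣ p ∣ + ∣ p ∣ ≤ n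
sparse-lastOutside-size [] _ _ = z≤n
sparse-lastOutside-size (false ∷ []) _ _ = z≤n
sparse-lastOutside-size (x ∷ y ∷ p) eq last =
  two-step (sparse-two x y p eq)
    (sparse-lastOutside-size p (sparse-tail y p (sparse-tail x (y ∷ p) eq)) (lastOutside-tail y p last))

half-bound : ∀ m c → c + c ≤ suc (m * 2) → c ≤ m
half-bound m c le = ≮⇒≥ λ m<c → <-irrefl refl (<-≤-trans (one-side-small m c c le m<c) m<c)

NoConsecutive : ∀ {n} → Subset n → Set
NoConsecutive {n} p = ∀ (i j : Fin n) → toℕ j ≡ suc (toℕ i) → ¬ (i ∈ p × j ∈ p)

noConsecutive⇒sparse : ∀ {n} (p : Subset n) → NoConsecutive p → sparse p ≡ true
noConsecutive⇒sparse [] _ = refl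
noConsecutive⇒sparse (x ∷ []) _ = refl
noConsecutive⇒sparse (true ∷ true ∷ p) nc = contradiction (here , there here) (nc zero (suc zero) refl)
noConsecutive⇒sparse (true ∷ false ∷ p) nc =
  noConsecutive⇒sparse (false ∷ p) λ i j eq (i∈ , j∈) → nc (suc i) (suc j) (cong suc eq) (there i∈ , there j∈)
noConsecutive⇒sparse (false ∷ y ∷ p) nc =
  noConsecutive⇒sparse (y ∷ p) λ i j eq (i∈ , j∈) → nc (suc i) (suc j) (cong suc eq) (there i∈ , there j∈)

last∉⇒lastOutside : ∀ {n} (p : Subset n) → (∀ j → suc (toℕ j) ≡ n → j ∉ p) → lastOutside p ≡ true
last∉⇒lastOutside [] _ = refl
last∉⇒lastOutside (false ∷ []) _ = refl
last∉⇒lastOutside (true ∷ []) out = contradiction here (out zero refl)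
last∉⇒lastOutside (x ∷ y ∷ p) out = last∉⇒lastOutside (y ∷ p) λ j eq j∈ → out (suc j) (cong suc eq) (there j∈)

-- The image depends on the two positions i with i , i + 1 ∉ A only through which of
-- them are below 4, and on the parity class of A if none is.  The last clause is only
-- reached by words that are not prefixes of stable k-sets of the (2k + 2)-cycle.
bitsCode : (a₀ a₁ a₂ a₃ a₄ : Bool) → Vertex (SymmetricShift 4)
bitsCode true  false true  false true  = (0F , 2F) , [ (λ ()) ]
bitsCode false true  false true  false = (2F , 0F) , [ (λ ()) ]
bitsCode false false true  false true  = (0F , 2F) , [ (λ ()) ]
bitsCode true  false false true  false = (2F , 3F) , [ (λ ()) ]
bitsCode false true  false false true  = (3F , 1F) , [ (λ ()) ]
bitsCode true  false true  false false = (0F , 3F) , [ (λ ()) ]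
bitsCode false false false true  false = (1F , 0F) , [ (λ ()) ]
bitsCode false false true  false false = (1F , 2F) , [ (λ ()) ]
bitsCode true  false false false true  = (0F , 1F) , [ (λ ()) ]
bitsCode false true  false false false = (3F , 0F) , [ (λ ()) ]
bitsCode _     _     _     _     _     = (0F , 1F) , [ (λ ()) ]

shiftCode : ∀ {n} → Subset (5 + n) → Vertex (SymmetricShift 4)
shiftCode (a ∷ b ∷ c ∷ d ∷ e ∷ _) = bitsCode a b c d e

shift-adjacent? : ∀ {m} u v → Dec (Adj (SymmetricShift m) u v)
shift-adjacent? ((i , j) , _) ((k , l) , _) = (j ≟ k) ⊎-dec (i ≟ l)

-- These are facts about the first six bits of a stable set that suffice for the finite check. If
-- the first bit is set, cyclic stability keeps the last position free, which gives the sharper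
-- bound on five bits.
Admissible : Subset 6 → Set
Admissible w = sparse w ≡ true × 2 ≤ ∣ w ∣ × (head w ≡ true → 2 ≤ ∣ take 5 w ∣)

admissible? : ∀ w → Dec (Admissible w)
admissible? w = (sparse w Bool.≟ true) ×-dec ((2 ≤ℕ? ∣ w ∣) ×-dec ((head w Bool.≟ true) →-dec (2 ≤ℕ? ∣ take 5 w ∣)))

-- An exhaustive search over pairs of six-bit words finds no counterexample, and decidability of
-- adjacency removes the double negation.
shiftCode-preserves : ∀ w w′ → Admissible w → Admissible w′ → Empty (w ∩ w′) →
                      Adj (SymmetricShift 4) (shiftCode w) (shiftCode w′)
shiftCode-preserves w w′ adm adm′ e = decidable-stable (shift-adjacent? (shiftCode w) (shiftCode w′))
  λ ¬adj → from-no exception? (w , adm , w′ , adm′ , e , ¬adj)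
  where
  exception? = anySubset? λ w → admissible? w ×-dec (anySubset? λ w′ → admissible? w′ ×-dec
    (¬? (nonempty? (w ∩ w′)) ×-dec ¬? (shift-adjacent? (shiftCode w) (shiftCode w′))))

prefix-large : ∀ c d m → c + d ≡ 2 + m → d ≤ m → 2 ≤ c
prefix-large c d m eq d≤m = +-cancelʳ-≤ m 2 c (≤-trans (≤-reflexive (sym eq)) (+-monoʳ-≤ c d≤m))

-- The last `2m` positions hold at most `m` of the `m + 2` elements, leaving two for the prefix.
-- When the last position is free, the same holds for the last `2m + 1` positions.
stable⇒admissible : ∀ m a b c d e f (r : Subset (m * 2)) → let A = a ∷ b ∷ c ∷ d ∷ e ∷ f ∷ r in
  ∣ A ∣ ≡ 2 + m → Stable A → Admissible (a ∷ b ∷ c ∷ d ∷ e ∷ f ∷ [])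
stable⇒admissible m a b c d e f r size (nc , cyc) =
  proj₁ split ,
  prefix-large ∣ w ∣ ∣ r ∣ m (trans (sym (∣++∣ w r)) size) (half-bound m ∣ r ∣ (sparse-size r (proj₂ split))) ,
  λ where refl → prefix-large ∣ w₅ ∣ ∣ f ∷ r ∣ m (trans (sym (∣++∣ w₅ (f ∷ r))) size)
                   (half-bound m ∣ f ∷ r ∣ (sparse-lastOutside-size (f ∷ r)
                     (proj₂ (sparse-++ w₅ (f ∷ r) A-sparse))
                     (lastOutside-++ w₅ (f ∷ r) (last∉⇒lastOutside A λ j eq j∈ → cyc zero j refl eq (here , j∈)))))
  where
  A = a ∷ b ∷ c ∷ d ∷ e ∷ f ∷ r
  w = a ∷ b ∷ c ∷ d ∷ e ∷ f ∷ []
  w₅ = a ∷ b ∷ c ∷ d ∷ e ∷ []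
  A-sparse = noConsecutive⇒sparse A nc
  split = sparse-++ w r A-sparse

SG-homomorphism : ∀ m → Homomorphism (SG (6 + m * 2) (2 + m)) (SymmetricShift 4)
SG-homomorphism m = record
  { map       = λ A → shiftCode (element (element A))
  ; preserves = λ {u} {v} → edge u v
  }
  where
  edge : ∀ u v → Adj (SG (6 + m * 2) (2 + m)) u v →
         Adj (SymmetricShift 4) (shiftCode (element (element u))) (shiftCode (element (element v)))
  edge ((a ∷ b ∷ c ∷ d ∷ e ∷ f ∷ r , [ size ]) , [ stable ])
       ((a′ ∷ b′ ∷ c′ ∷ d′ ∷ e′ ∷ f′ ∷ r′ , [ size′ ]) , [ stable′ ]) disjoint =
    -- The size and stability proofs are irrelevant, so the adjacency derived from them must be
    -- recovered by deciding it.
    recompute (shift-adjacent? (shiftCode w) (shiftCode w′))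
      (shiftCode-preserves w w′ (stable⇒admissible m a b c d e f r size stable)
        (stable⇒admissible m a′ b′ c′ d′ e′ f′ r′ size′ stable′)
        (empty-++ (w ∩ w′) (r ∩ r′) disjoint))
    where
    w = a ∷ b ∷ c ∷ d ∷ e ∷ f ∷ []
    w′ = a′ ∷ b′ ∷ c′ ∷ d′ ∷ e′ ∷ f′ ∷ []

mainTheorem3 : ((k : ℕ) → 2 ≤ k → Homomorphism (SG (2 * k + 2) k) (SymmetricShift 4))
    × ((k : ℕ) → 1 ≤ k → ¬ Homomorphism (KG (2 * k + 2) k) (SymmetricShift 4))
mainTheorem3 =
  (λ where (suc (suc m)) (s≤s (s≤s _)) →
             subst (λ n → Homomorphism (SG n (2 + m)) (SymmetricShift 4)) (size (2 + m)) (SG-homomorphism m)) ,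
  (λ where (suc j) _ hom → no-KG-homomorphism j
             (subst (λ n → Homomorphism (KG n (suc j)) (SymmetricShift 4)) (sym (size (suc j))) hom))
  where
  -- The left-hand form computes to `6 + m * 2` at `k = 2 + m` and to `(2 + j) * 2` at `k = suc j`.
  size : ∀ k → suc k * 2 ≡ 2 * k + 2
  size k = trans (+-comm 2 (k * 2)) (cong (_+ 2) (*-comm k 2))
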